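{- For every fixed integer $k\le -2$, \[ M_k(n)=\frac{1}{12(1+2\sqrt2)^2}\,n^3+O_k(n^2)\qquad(n\to\infty). \] Equivalently, if $k=-t$ with $t\ge 2$ and $N=n-t$, then $M_{ -t}(n)=\frac{1}{12(1+2\sqrt2)^2}N^3+O_t(N^2)$.
   Context: For $k\in\mathbb Z$ and $n\ge 1$, $M_k(n)$ is the minimum, over all $2$-colorings $\Delta:[k+1,k+n]\to\{0,1\}$ (where $[a,b]=\{m\in\mathbb Z:a\le m\le b\}$), of the number of triples $(x_1,x_2,x_3)$ with $x_1,x_2,x_3\in[k+1,k+n]$, $x_1\le x_2\le x_3$, $x_1+x_2<x_3$ and $\Delta(x_1)=\Delta(x_2)=\Delta(x_3)$. $O_k(\cdot)$ indicates that the implied constant may depend on $k$. -}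

module Defs where

open import Data.Bool using (Bool; true; false; _∧_)
open import Data.Nat as ℕ using (ℕ; zero; suc; _⊓_)
open import Data.Fin using (Fin; toℕ)
import Data.Fin
open import Data.List using (List; []; _∷_; map; concatMap; allFin; filterᵇ; length; foldr)
open import Data.Integer as ℤ using (ℤ; +_; _+_; _*_; _≤_)
open import Data.Product using (_×_; _,_)
open import Data.Sum using (_⊎_)
open import Relation.Nullary.Decidable using (⌊_⌋)
import Data.Bool.Properties as BoolP

-- A 2-colouring of [k+1, k+n]; index i : Fin n stands for the integer k+1+i.
Coloring : ℕ → Set
Coloring n = Fin n → Bool

val : ℤ → {n : ℕ} → Fin n → ℤ
val k i = k + + 1 + + toℕ i

triples : (n : ℕ) → List (Fin n × Fin n × Fin n)
triples n = concatMap (λ a → concatMap (λ b → map (λ c → (a , b , c)) (allFin n)) (allFin n)) (allFin n)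

good : (k : ℤ) {n : ℕ} → Coloring n → Fin n × Fin n × Fin n → Bool
good k Δ (a , b , c) =
  ⌊ val k a ℤ.≤? val k b ⌋ ∧ ⌊ val k b ℤ.≤? val k c ⌋ ∧ ⌊ (val k a + val k b) ℤ.<? val k c ⌋
  ∧ ⌊ Δ a BoolP.≟ Δ b ⌋ ∧ ⌊ Δ b BoolP.≟ Δ c ⌋

count : (k : ℤ) (n : ℕ) → Coloring n → ℕ
count k n Δ = length (filterᵇ (good k Δ) (triples n))

allColorings : (n : ℕ) → List (Coloring n)
allColorings zero = (λ ()) ∷ []
allColorings (suc n) =
  concatMap (λ Δ → (λ { Data.Fin.zero → false ; (Data.Fin.suc i) → Δ i })
                 ∷ (λ { Data.Fin.zero → true ; (Data.Fin.suc i) → Δ i }) ∷ []) (allColorings n)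

-- M_k(n): minimum of count over all colourings (the all-false colouring is
-- one of them, so it is a legitimate starting value for the fold)
M : ℤ → ℕ → ℕ
M k n = foldr _⊓_ (count k n (λ _ → false)) (map (count k n) (allColorings n))

-- x·√2 ≤ y for integers x, y (exact encoding without reals)
_√2≤_ : ℤ → ℤ → Set
x √2≤ y = (x ≤ + 0 × + 0 ≤ y)
        ⊎ (x ≤ + 0 × y ≤ + 0 × y * y ≤ + 2 * x * x)
        ⊎ (+ 0 ≤ x × + 0 ≤ y × + 2 * x * x ≤ y * y)

{-# OPTIONS --safe #-}

-- For k ≤ −2 the offsets of [k+1, k+n] reduce the problem to counting monochromatic i + j < l
-- with 0 ≤ i, j, l < n, up to O(n²). Being monochromatic is a quadratic condition on signs
-- s = ±1: four times its indicator is 1 + sᵢsⱼ + sᵢsₗ + sⱼsₗ. With partial sums S, m = S(n),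
-- p = S(t) and q = S(n−t), summation by parts and completing squares turn the ordered count R into
--   16 R = 4 ∑ₜ t(n−t) + 4(n+1)m² − ∑ₜ (A² + 3B²),   A = p + q − 2m,   B = p − q.
-- For n = 2N, reading a colouring from both ends, each of N steps moves exactly one of A, B, by ±2;
-- both start at size |m| = 2ν and B ends at 0. An exchange argument on these lattice paths shows that
-- ∑ (A² + 3B²) is largest, up to O(n²), if all A-steps come first and there are exactly ν B-steps,
-- that is, for the colouring with blocks [0, a) and [a, n), a = N − ν. So twelve times the unordered count
-- is at least a³ + u³ − O(n²) with 2a + u = n, and the two-block colourings attain this.
-- Finally min (a³ + u³) = n³/(1 + 2√2)², reached for a = √2 u.

module Submission where

open import Defs
open import Algebra.Bundles using (AbelianGroup; CommutativeSemiring)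
import Algebra.Properties.CommutativeSemigroup as CommSemigroup
import Algebra.Properties.Group as GroupProperties
open import Data.Bool using (Bool; true; false; _∧_; _xor_; if_then_else_)
import Data.Bool.Properties as Boolₚ
open import Data.Empty using (⊥-elim)
open import Data.Fin as Fin using (Fin; toℕ)
open import Data.Integer as ℤ using (ℤ; -[1+_])
import Data.Integer.Properties as ℤₚ
import Data.Integer.Tactic.RingSolver as ℤ-Solver
open import Data.List using (List; []; _∷_; _++_; map; concatMap; filterᵇ; foldr; length; tabulate; allFin)
import Data.List.Properties as Listₚ
open import Data.List.Membership.Propositional using (_∈_; find)
open import Data.List.Membership.Propositional.Properties using (∈-map⁺)
open import Data.List.Relation.Unary.Any as Any using (Any; here; there)
import Data.List.Relation.Unary.Any.Properties as Anyₚ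
open import Data.Nat as ℕ using (ℕ; zero; suc; z≤n; s≤s; _∸_; _^_; _⊓_; ⌊_/2⌋; ⌈_/2⌉)
open import Data.Nat.ListAction using (sum)
import Data.Nat.Properties as ℕₚ
import Data.Nat.Tactic.RingSolver as ℕ-Solver
open import Data.Product using (∃-syntax; _×_; _,_; proj₁; proj₂)
open import Data.Sum using (_⊎_; inj₁; inj₂; map₂)
open import Function using (_∘_; _$_; id)
open import Level using (Level)
open import Relation.Binary.Definitions using (tri<; tri≈; tri>)
import Relation.Binary.Reasoning.Setoid as SetoidReasoning
open import Relation.Nullary using (Dec; yes; no; does; ¬_)
open import Relation.Nullary.Decidable using (⌊_⌋; _×-dec_; dec-true; dec-false)

-- Everything stays in exact integer arithmetic. Since (1 + 2√2)² = 9 + 4√2, the inequality 12 (1 +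
-- 2√2)² x ≤ n³ reads 48√2 x ≤ n³ - 108 x, and squared 4608 x² ≤ (n³ - 108 x)². Hence every O(n²)
-- becomes an explicit multiple of n². The obstacle in the path problem is that |B| need not
-- decrease from the start: it may first climb, spending e more b-steps than the ν it needs.
-- Replacing A² and 3B² by envelopes that depend only on the number of a-steps, respectively
-- b-steps, made so far decouples the two coordinates. Moving all a-steps to the front then becomes
-- a local inequality for each a-step, exact for e = 0 and otherwise with an error carrying a factor
-- e. The cubic estimate of the total shows that even with this error a surplus e > 0 does not pay.

module Summation {c ℓ : Level} (R : CommutativeSemiring c ℓ) where
  open CommutativeSemiring R
  open SetoidReasoning setoid
  open CommSemigroup +-commutativeSemigroup using (interchange)

  ∑ : ℕ → (ℕ → Carrier) → Carrier
  ∑ zero    f = 0#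
  ∑ (suc n) f = ∑ n f + f n

  ∑-cong< : ∀ n {f g} → (∀ i → i ℕ.< n → f i ≈ g i) → ∑ n f ≈ ∑ n g
  ∑-cong< zero    h = refl
  ∑-cong< (suc n) h = +-cong (∑-cong< n (λ i i<n → h i (ℕₚ.m<n⇒m<1+n i<n))) (h n (ℕₚ.n<1+n n))

  ∑-cong : ∀ n {f g} → (∀ i → f i ≈ g i) → ∑ n f ≈ ∑ n g
  ∑-cong n h = ∑-cong< n (λ i _ → h i)

  ∑-zero : ∀ n → ∑ n (λ _ → 0#) ≈ 0#
  ∑-zero zero    = refl
  ∑-zero (suc n) = trans (+-cong (∑-zero n) refl) (+-identityʳ 0#)

  ∑-+ : ∀ n f g → ∑ n (λ i → f i + g i) ≈ ∑ n f + ∑ n g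
  ∑-+ zero    f g = sym (+-identityˡ 0#)
  ∑-+ (suc n) f g = trans (+-cong (∑-+ n f g) refl) (interchange _ _ _ _)

  ∑-*ˡ : ∀ n x f → ∑ n (λ i → x * f i) ≈ x * ∑ n f
  ∑-*ˡ zero    x f = sym (zeroʳ x)
  ∑-*ˡ (suc n) x f = trans (+-cong (∑-*ˡ n x f) refl) (sym (distribˡ x _ _))

  ∑-swap : ∀ m n (f : ℕ → ℕ → Carrier) →
           ∑ m (λ i → ∑ n (λ j → f i j)) ≈ ∑ n (λ j → ∑ m (λ i → f i j))
  ∑-swap zero    n f = sym (∑-zero n)
  ∑-swap (suc m) n f = trans (+-cong (∑-swap m n f) refl) (sym (∑-+ n _ _))

  ∑-head : ∀ n f → ∑ (suc n) f ≈ f 0 + ∑ n (λ i → f (suc i))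
  ∑-head zero    f = +-comm _ _
  ∑-head (suc n) f = trans (+-cong (∑-head n f) refl) (+-assoc _ _ _)

  ∑-reverse : ∀ n f → ∑ (suc n) f ≈ ∑ (suc n) (λ i → f (n ∸ i))
  ∑-reverse zero    f = refl
  ∑-reverse (suc n) f = begin
    ∑ (suc n) f + f (suc n)                    ≈⟨ +-comm _ _ ⟩
    f (suc n) + ∑ (suc n) f                    ≈⟨ +-cong refl (∑-reverse n f) ⟩
    f (suc n) + ∑ (suc n) (λ i → f (n ∸ i))    ≈⟨ ∑-head (suc n) (λ i → f (suc n ∸ i)) ⟨
    ∑ (suc (suc n)) (λ i → f (suc n ∸ i))      ∎

  ∑-split : ∀ m n f → ∑ (m ℕ.+ n) f ≈ ∑ m f + ∑ n (λ i → f (m ℕ.+ i))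
  ∑-split m zero    f rewrite ℕₚ.+-identityʳ m = sym (+-identityʳ _)
  ∑-split m (suc n) f rewrite ℕₚ.+-suc m n = trans (+-cong (∑-split m n f) refl) (+-assoc _ _ _)

open import Relation.Binary.PropositionalEquality
open Summation ℕₚ.+-*-commutativeSemiring using () renaming
  (∑ to ∑ℕ; ∑-cong to ∑ℕ-cong; ∑-+ to ∑ℕ-+; ∑-*ˡ to ∑ℕ-*ˡ; ∑-swap to ∑ℕ-swap; ∑-head to ∑ℕ-head; ∑-split to ∑ℕ-split)

∑ℕ-mono< : ∀ n {f g : ℕ → ℕ} → (∀ i → i ℕ.< n → f i ℕ.≤ g i) → ∑ℕ n f ℕ.≤ ∑ℕ n g
∑ℕ-mono< zero    h = ℕ.z≤n
∑ℕ-mono< (suc n) h = ℕₚ.+-mono-≤ (∑ℕ-mono< n (λ i i<n → h i (ℕₚ.m<n⇒m<1+n i<n))) (h n (ℕₚ.n<1+n n))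

∑ℕ-mono : ∀ n {f g : ℕ → ℕ} → (∀ i → f i ℕ.≤ g i) → ∑ℕ n f ℕ.≤ ∑ℕ n g
∑ℕ-mono n h = ∑ℕ-mono< n (λ i _ → h i)

∑ℕ-extend : ∀ {m n} f → m ℕ.≤ n → ∑ℕ m f ℕ.≤ ∑ℕ n f
∑ℕ-extend {m} {n} f m≤n = begin
  ∑ℕ m f               ≤⟨ ℕₚ.m≤m+n _ _ ⟩
  ∑ℕ m f ℕ.+ ∑ℕ (n ∸ m) (λ i → f (m ℕ.+ i)) ≡⟨ ∑ℕ-split m (n ∸ m) f ⟨
  ∑ℕ (m ℕ.+ (n ∸ m)) f ≡⟨ cong (λ x → ∑ℕ x f) (ℕₚ.m+[n∸m]≡n m≤n) ⟩
  ∑ℕ n f               ∎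
  where open ℕₚ.≤-Reasoning

-- Counting solutions as iterated sums

module _ where

  open import Data.Nat using (_≤_; _<_)
  open import Data.Integer using (+_)

  ⟦_⟧ : {P : Set} → Dec P → ℕ
  ⟦ p? ⟧ = if does p? then 1 else 0

  ⟦⟧-mono : {P Q : Set} (p? : Dec P) (q? : Dec Q) → (P → Q) → ⟦ p? ⟧ ≤ ⟦ q? ⟧
  ⟦⟧-mono (no _)  q?      h = z≤n
  ⟦⟧-mono (yes p) (yes _) h = ℕₚ.≤-refl
  ⟦⟧-mono (yes p) (no ¬q) h = ⊥-elim (¬q (h p))

  ⟦⟧≤1 : {P : Set} (p? : Dec P) → ⟦ p? ⟧ ≤ 1
  ⟦⟧≤1 (yes _) = ℕₚ.≤-refl
  ⟦⟧≤1 (no _)  = z≤n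

  ⟦⟧≡1 : {P : Set} (p? : Dec P) → P → ⟦ p? ⟧ ≡ 1
  ⟦⟧≡1 (yes _) p = refl
  ⟦⟧≡1 (no ¬p) p = ⊥-elim (¬p p)

  ⟦⟧≡0 : {P : Set} (p? : Dec P) → ¬ P → ⟦ p? ⟧ ≡ 0
  ⟦⟧≡0 (yes p) ¬p = ⊥-elim (¬p p)
  ⟦⟧≡0 (no _)  ¬p = refl

  ⌊⌋≡does : {P Q : Set} (p? : Dec P) (q? : Dec Q) → (P → Q) → (Q → P) → ⌊ p? ⌋ ≡ does q?
  ⌊⌋≡does (yes p) (yes q) f g = refl
  ⌊⌋≡does (yes p) (no ¬q) f g = ⊥-elim (¬q (f p))
  ⌊⌋≡does (no ¬p) (yes q) f g = ⊥-elim (¬p (g q))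
  ⌊⌋≡does (no ¬p) (no ¬q) f g = refl

  module _ {A B : Set} where

    length-filterᵇ-map : (p : B → Bool) (f : A → B) (xs : List A) →
      length (filterᵇ p (map f xs)) ≡ sum (map (λ x → if p (f x) then 1 else 0) xs)
    length-filterᵇ-map p f []       = refl
    length-filterᵇ-map p f (x ∷ xs) with p (f x)
    ... | true  = cong suc (length-filterᵇ-map p f xs)
    ... | false = length-filterᵇ-map p f xs

    length-filterᵇ-++ : (p : B → Bool) (xs ys : List B) →
      length (filterᵇ p (xs ++ ys)) ≡ length (filterᵇ p xs) ℕ.+ length (filterᵇ p ys)
    length-filterᵇ-++ p []       ys = refl
    length-filterᵇ-++ p (x ∷ xs) ys with p x
    ... | true  = cong suc (length-filterᵇ-++ p xs ys)
    ... | false = length-filterᵇ-++ p xs ys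

    length-filterᵇ-concatMap : (p : B → Bool) (f : A → List B) (xs : List A) →
      length (filterᵇ p (concatMap f xs)) ≡ sum (map (λ x → length (filterᵇ p (f x))) xs)
    length-filterᵇ-concatMap p f []       = refl
    length-filterᵇ-concatMap p f (x ∷ xs) =
      trans (length-filterᵇ-++ p (f x) (concatMap f xs))
            (cong (length (filterᵇ p (f x)) ℕ.+_) (length-filterᵇ-concatMap p f xs))

  sum-tabulate : ∀ n (h : Fin n → ℕ) (f : ℕ → ℕ) → (∀ i → h i ≡ f (toℕ i)) →
                 sum (tabulate h) ≡ ∑ℕ n f
  sum-tabulate zero    h f eq = refl
  sum-tabulate (suc n) h f eq = begin
    h Fin.zero ℕ.+ sum (tabulate (h ∘ Fin.suc))
      ≡⟨ cong₂ ℕ._+_ (eq Fin.zero) (sum-tabulate n (h ∘ Fin.suc) (f ∘ suc) (eq ∘ Fin.suc)) ⟩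
    f 0 ℕ.+ ∑ℕ n (f ∘ suc)
      ≡⟨ ∑ℕ-head n f ⟨
    ∑ℕ (suc n) f ∎
    where open ≡-Reasoning

  sum-allFin : ∀ n (h : Fin n → ℕ) (f : ℕ → ℕ) → (∀ i → h i ≡ f (toℕ i)) →
               sum (map h (allFin n)) ≡ ∑ℕ n f
  sum-allFin n h f eq = trans (cong sum (Listₚ.map-tabulate id h)) (sum-tabulate n h f eq)

  length-filterᵇ-triples : ∀ n (p : Fin n × Fin n × Fin n → Bool)
    {Q : ℕ → ℕ → ℕ → Set} (q? : ∀ i j l → Dec (Q i j l)) →
    (∀ a b c → p (a , b , c) ≡ does (q? (toℕ a) (toℕ b) (toℕ c))) →
    length (filterᵇ p (triples n)) ≡ ∑ℕ n (λ i → ∑ℕ n (λ j → ∑ℕ n (λ l → ⟦ q? i j l ⟧)))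
  length-filterᵇ-triples n p q? eq =
    trans (length-filterᵇ-concatMap p _ (allFin n)) $ sum-allFin n _ _ λ a →
    trans (length-filterᵇ-concatMap p _ (allFin n)) $ sum-allFin n _ _ λ b →
    trans (length-filterᵇ-map p (λ c → a , b , c) (allFin n)) $ sum-allFin n _ _ λ c →
    cong (λ t → if t then 1 else 0) (eq a b c)

  extend : ∀ {n} → Coloring n → ℕ → Bool
  extend {zero}  Δ _       = false
  extend {suc n} Δ zero    = Δ Fin.zero
  extend {suc n} Δ (suc i) = extend (Δ ∘ Fin.suc) i

  extend-toℕ : ∀ {n} (Δ : Coloring n) (i : Fin n) → extend Δ (toℕ i) ≡ Δ i
  extend-toℕ Δ Fin.zero    = refl
  extend-toℕ Δ (Fin.suc i) = extend-toℕ (Δ ∘ Fin.suc) i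

  -- With k = -[1+ d ], the integer at offset i of [k+1, k+n] is i − d.
  Solution : ℕ → (ℕ → Bool) → ℕ → ℕ → ℕ → Set
  Solution d χ l i j = i ℕ.+ j < l ℕ.+ d × χ i ≡ χ j × χ j ≡ χ l

  solution? : ∀ d χ l i j → Dec (Solution d χ l i j)
  solution? d χ l i j = (i ℕ.+ j ℕ.<? l ℕ.+ d) ×-dec (χ i Boolₚ.≟ χ j) ×-dec (χ j Boolₚ.≟ χ l)

  solution-sym : ∀ d χ l i j → Solution d χ l i j → Solution d χ l j i
  solution-sym d χ l i j (i+j<l+d , i≡j , j≡l) =
    subst (_< l ℕ.+ d) (ℕₚ.+-comm i j) i+j<l+d , sym i≡j , trans i≡j j≡l

  module _ (d : ℕ) {n : ℕ} where

    private
      k = -[1+ d ]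

      val≡ : ∀ (a : Fin n) → val k a ≡ + toℕ a ℤ.- + d
      val≡ a = shift d (toℕ a)
        where
        shift : ∀ d i → -[1+ d ] ℤ.+ + 1 ℤ.+ + i ≡ + i ℤ.- + d
        shift zero    i = trans (ℤₚ.+-identityˡ (+ i)) (sym (ℤₚ.+-identityʳ (+ i)))
        shift (suc d) i = ℤₚ.+-comm -[1+ d ] (+ i)

      val+d : ∀ (a : Fin n) → val k a ℤ.+ + d ≡ + toℕ a
      val+d a = trans (cong (ℤ._+ + d) (val≡ a)) (lemma (+ toℕ a) (+ d))
        where
        lemma : ∀ x z → x ℤ.- z ℤ.+ z ≡ x
        lemma = ℤ-Solver.solve-∀

      sum+2d : ∀ (a b : Fin n) → (val k a ℤ.+ val k b) ℤ.+ (+ d ℤ.+ + d) ≡ + (toℕ a ℕ.+ toℕ b)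
      sum+2d a b = trans (lemma (val k a) (val k b) (+ d)) (cong₂ ℤ._+_ (val+d a) (val+d b))
        where
        lemma : ∀ x y z → x ℤ.+ y ℤ.+ (z ℤ.+ z) ≡ (x ℤ.+ z) ℤ.+ (y ℤ.+ z)
        lemma = ℤ-Solver.solve-∀

      val+2d : ∀ (c : Fin n) → val k c ℤ.+ (+ d ℤ.+ + d) ≡ + (toℕ c ℕ.+ d)
      val+2d c = trans (sym (ℤₚ.+-assoc (val k c) (+ d) (+ d))) (cong (ℤ._+ + d) (val+d c))

      cancelʳ-≤ : ∀ x {y z} → y ℤ.+ x ℤ.≤ z ℤ.+ x → y ℤ.≤ z
      cancelʳ-≤ x {y} {z} p = subst₂ ℤ._≤_ (lemma x y) (lemma x z) (ℤₚ.+-monoˡ-≤ (ℤ.- x) p)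
        where
        lemma : ∀ x y → y ℤ.+ x ℤ.+ ℤ.- x ≡ y
        lemma = ℤ-Solver.solve-∀

      cancelʳ-< : ∀ x {y z} → y ℤ.+ x ℤ.< z ℤ.+ x → y ℤ.< z
      cancelʳ-< x {y} {z} p = subst₂ ℤ._<_ (lemma x y) (lemma x z) (ℤₚ.+-monoˡ-< (ℤ.- x) p)
        where
        lemma : ∀ x y → y ℤ.+ x ℤ.+ ℤ.- x ≡ y
        lemma = ℤ-Solver.solve-∀

    val-≤? : ∀ (a b : Fin n) → ⌊ val k a ℤ.≤? val k b ⌋ ≡ does (toℕ a ℕ.≤? toℕ b)
    val-≤? a b = ⌊⌋≡does (val k a ℤ.≤? val k b) (toℕ a ℕ.≤? toℕ b)
      (λ p → ℤₚ.drop‿+≤+ (subst₂ ℤ._≤_ (val+d a) (val+d b) (ℤₚ.+-monoˡ-≤ (+ d) p)))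
      (λ p → cancelʳ-≤ (+ d) (subst₂ ℤ._≤_ (sym (val+d a)) (sym (val+d b)) (ℤ.+≤+ p)))

    val-<? : ∀ (a b c : Fin n) →
             ⌊ (val k a ℤ.+ val k b) ℤ.<? val k c ⌋ ≡ does (toℕ a ℕ.+ toℕ b ℕ.<? toℕ c ℕ.+ d)
    val-<? a b c = ⌊⌋≡does (val k a ℤ.+ val k b ℤ.<? val k c) (toℕ a ℕ.+ toℕ b ℕ.<? toℕ c ℕ.+ d)
      (λ p → ℤₚ.drop‿+<+ (subst₂ ℤ._<_ (sum+2d a b) (val+2d c) (ℤₚ.+-monoˡ-< (+ d ℤ.+ + d) p)))
      (λ p → cancelʳ-< (+ d ℤ.+ + d) (subst₂ ℤ._<_ (sym (sum+2d a b)) (sym (val+2d c)) (ℤ.+<+ p)))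

  count≡∑ : ∀ d n (Δ : Coloring n) → count -[1+ d ] n Δ ≡
    ∑ℕ n (λ i → ∑ℕ n (λ j → ∑ℕ n (λ l →
      ⟦ i ℕ.≤? j ×-dec j ℕ.≤? l ×-dec solution? d (extend Δ) l i j ⟧)))
  count≡∑ d n Δ = length-filterᵇ-triples n (good -[1+ d ] Δ)
    (λ i j l → i ℕ.≤? j ×-dec j ℕ.≤? l ×-dec solution? d (extend Δ) l i j) λ a b c →
    cong₂ _∧_ (val-≤? d a b) $ cong₂ _∧_ (val-≤? d b c) $ cong₂ _∧_ (val-<? d a b c) $
    cong₂ _∧_ (colour-≟ a b) (colour-≟ b c)
    where
    colour-≟ : ∀ a b → ⌊ Δ a Boolₚ.≟ Δ b ⌋ ≡ does (extend Δ (toℕ a) Boolₚ.≟ extend Δ (toℕ b))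
    colour-≟ a b = ⌊⌋≡does _ (extend Δ (toℕ a) Boolₚ.≟ extend Δ (toℕ b))
      (subst₂ _≡_ (sym (extend-toℕ Δ a)) (sym (extend-toℕ Δ b)))
      (subst₂ _≡_ (extend-toℕ Δ a) (extend-toℕ Δ b))

  ∑ℕ-rotate : ∀ n (f : ℕ → ℕ → ℕ → ℕ) →
    ∑ℕ n (λ i → ∑ℕ n (λ j → ∑ℕ n (λ l → f i j l))) ≡ ∑ℕ n (λ l → ∑ℕ n (λ i → ∑ℕ n (λ j → f i j l)))
  ∑ℕ-rotate n f = trans (∑ℕ-cong n (λ i → ∑ℕ-swap n n (f i))) (∑ℕ-swap n n _)

  ∑∑ : ℕ → (ℕ → ℕ → ℕ) → ℕ
  ∑∑ n f = ∑ℕ n (λ i → ∑ℕ n (f i))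

  ∑∑-mono : ∀ n {f g : ℕ → ℕ → ℕ} → (∀ i j → f i j ≤ g i j) → ∑∑ n f ≤ ∑∑ n g
  ∑∑-mono n h = ∑ℕ-mono n (λ i → ∑ℕ-mono n (h i))

  ∑∑-+ : ∀ n (f g : ℕ → ℕ → ℕ) → ∑∑ n (λ i j → f i j ℕ.+ g i j) ≡ ∑∑ n f ℕ.+ ∑∑ n g
  ∑∑-+ n f g = trans (∑ℕ-cong n (λ i → ∑ℕ-+ n (f i) (g i))) (∑ℕ-+ n _ _)

  solutions : ℕ → ℕ → (ℕ → Bool) → ℕ → ℕ
  solutions d n χ l = ∑∑ n (λ i j → ⟦ solution? d χ l i j ⟧)

  ∑ℕ-const : ∀ n x → ∑ℕ n (λ _ → x) ≡ n ℕ.* x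
  ∑ℕ-const zero    x = refl
  ∑ℕ-const (suc n) x = trans (ℕₚ.+-comm (∑ℕ n (λ _ → x)) x) (cong (x ℕ.+_) (∑ℕ-const n x))

  -- Forgetting the order of x₁ and x₂ doubles the count, up to the diagonal.
  module _ (n : ℕ) {P : ℕ → ℕ → Set} (p? : ∀ i j → Dec (P i j)) (p-sym : ∀ i j → P i j → P j i) where

    private
      q? : ∀ i j → Dec (i ≤ j × P i j)
      q? i j = i ℕ.≤? j ×-dec p? i j

      twice : 2 ℕ.* ∑∑ n (λ i j → ⟦ q? i j ⟧) ≡ ∑∑ n (λ i j → ⟦ q? i j ⟧ ℕ.+ ⟦ q? j i ⟧)
      twice = begin
        2 ℕ.* ∑∑ n (λ i j → ⟦ q? i j ⟧)
          ≡⟨ cong (∑∑ n (λ i j → ⟦ q? i j ⟧) ℕ.+_) (ℕₚ.+-identityʳ _) ⟩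
        ∑∑ n (λ i j → ⟦ q? i j ⟧) ℕ.+ ∑∑ n (λ i j → ⟦ q? i j ⟧)
          ≡⟨ cong (∑∑ n (λ i j → ⟦ q? i j ⟧) ℕ.+_) (∑ℕ-swap n n (λ i j → ⟦ q? i j ⟧)) ⟩
        ∑∑ n (λ i j → ⟦ q? i j ⟧) ℕ.+ ∑∑ n (λ i j → ⟦ q? j i ⟧)
          ≡⟨ ∑∑-+ n _ _ ⟨
        ∑∑ n (λ i j → ⟦ q? i j ⟧ ℕ.+ ⟦ q? j i ⟧) ∎
        where open ≡-Reasoning

      lower : ∀ i j → ⟦ p? i j ⟧ ≤ ⟦ q? i j ⟧ ℕ.+ ⟦ q? j i ⟧
      lower i j with ℕₚ.≤-total i j
      ... | inj₁ i≤j = ℕₚ.≤-trans (⟦⟧-mono (p? i j) (q? i j) (i≤j ,_)) (ℕₚ.m≤m+n _ _)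
      ... | inj₂ j≤i = ℕₚ.≤-trans (⟦⟧-mono (p? i j) (q? j i) (λ p → j≤i , p-sym i j p)) (ℕₚ.m≤n+m _ _)

      upper : ∀ i j → ⟦ q? i j ⟧ ℕ.+ ⟦ q? j i ⟧ ≤ ⟦ p? i j ⟧ ℕ.+ ⟦ i ℕ.≟ j ⟧
      upper i j with ℕₚ.<-cmp i j
      ... | tri< i<j _ _ = ℕₚ.+-mono-≤ (⟦⟧-mono (q? i j) (p? i j) proj₂)
        (⟦⟧-mono (q? j i) (i ℕ.≟ j) λ (j≤i , _) → ⊥-elim (ℕₚ.<⇒≱ i<j j≤i))
      ... | tri≈ _ i≡j _ = ℕₚ.+-mono-≤ (⟦⟧-mono (q? i j) (p? i j) proj₂)
        (⟦⟧-mono (q? j i) (i ℕ.≟ j) λ _ → i≡j)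
      ... | tri> _ _ j<i = subst (_≤ ⟦ p? i j ⟧ ℕ.+ ⟦ i ℕ.≟ j ⟧) (ℕₚ.+-comm ⟦ q? j i ⟧ ⟦ q? i j ⟧)
        (ℕₚ.+-mono-≤ (⟦⟧-mono (q? j i) (p? i j) (p-sym j i ∘ proj₂))
          (⟦⟧-mono (q? i j) (i ℕ.≟ j) λ (i≤j , _) → ⊥-elim (ℕₚ.<⇒≱ j<i i≤j)))

      -- The weaker bound 1 would not survive the induction: at `i = n` the earlier terms have to be
      -- known to vanish.
      diagonal : ∀ n i → ∑ℕ n (λ j → ⟦ i ℕ.≟ j ⟧) ≤ ⟦ i ℕ.<? n ⟧
      diagonal zero    i = z≤n
      diagonal (suc n) i with ℕₚ.<-cmp i n
      ... | tri< i<n i≢n _ = begin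
        ∑ℕ n (λ j → ⟦ i ℕ.≟ j ⟧) ℕ.+ ⟦ i ℕ.≟ n ⟧ ≡⟨ cong (∑ℕ n (λ j → ⟦ i ℕ.≟ j ⟧) ℕ.+_) (⟦⟧≡0 (i ℕ.≟ n) i≢n) ⟩
        ∑ℕ n (λ j → ⟦ i ℕ.≟ j ⟧) ℕ.+ 0           ≡⟨ ℕₚ.+-identityʳ _ ⟩
        ∑ℕ n (λ j → ⟦ i ℕ.≟ j ⟧)                 ≤⟨ diagonal n i ⟩
        ⟦ i ℕ.<? n ⟧                             ≤⟨ ⟦⟧-mono (i ℕ.<? n) (i ℕ.<? suc n) ℕₚ.m<n⇒m<1+n ⟩
        ⟦ i ℕ.<? suc n ⟧                         ∎
        where open ℕₚ.≤-Reasoning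
      ... | tri≈ i≮n i≡n _ = begin
        ∑ℕ n (λ j → ⟦ i ℕ.≟ j ⟧) ℕ.+ ⟦ i ℕ.≟ n ⟧ ≤⟨ ℕₚ.+-mono-≤ (diagonal n i) (⟦⟧≤1 (i ℕ.≟ n)) ⟩
        ⟦ i ℕ.<? n ⟧ ℕ.+ 1                       ≡⟨ cong (ℕ._+ 1) (⟦⟧≡0 (i ℕ.<? n) i≮n) ⟩
        1                                        ≡⟨ ⟦⟧≡1 (i ℕ.<? suc n) (s≤s (ℕₚ.≤-reflexive i≡n)) ⟨
        ⟦ i ℕ.<? suc n ⟧                         ∎
        where open ℕₚ.≤-Reasoning
      ... | tri> i≮n i≢n n<i = begin
        ∑ℕ n (λ j → ⟦ i ℕ.≟ j ⟧) ℕ.+ ⟦ i ℕ.≟ n ⟧ ≤⟨ ℕₚ.+-mono-≤ (diagonal n i) (ℕₚ.≤-reflexive (⟦⟧≡0 (i ℕ.≟ n) i≢n)) ⟩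
        ⟦ i ℕ.<? n ⟧ ℕ.+ 0                       ≡⟨ cong (ℕ._+ 0) (⟦⟧≡0 (i ℕ.<? n) i≮n) ⟩
        0                                        ≤⟨ z≤n ⟩
        ⟦ i ℕ.<? suc n ⟧                         ∎
        where open ℕₚ.≤-Reasoning

    unordered≥ : ∑∑ n (λ i j → ⟦ p? i j ⟧) ≤ 2 ℕ.* ∑∑ n (λ i j → ⟦ i ℕ.≤? j ×-dec p? i j ⟧)
    unordered≥ = ℕₚ.≤-trans (∑∑-mono n lower) (ℕₚ.≤-reflexive (sym twice))

    unordered≤ : 2 ℕ.* ∑∑ n (λ i j → ⟦ i ℕ.≤? j ×-dec p? i j ⟧) ≤ ∑∑ n (λ i j → ⟦ p? i j ⟧) ℕ.+ n
    unordered≤ = begin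
      2 ℕ.* ∑∑ n (λ i j → ⟦ q? i j ⟧)
        ≡⟨ twice ⟩
      ∑∑ n (λ i j → ⟦ q? i j ⟧ ℕ.+ ⟦ q? j i ⟧)
        ≤⟨ ∑∑-mono n upper ⟩
      ∑∑ n (λ i j → ⟦ p? i j ⟧ ℕ.+ ⟦ i ℕ.≟ j ⟧)
        ≡⟨ ∑∑-+ n _ _ ⟩
      ∑∑ n (λ i j → ⟦ p? i j ⟧) ℕ.+ ∑∑ n (λ i j → ⟦ i ℕ.≟ j ⟧)
        ≤⟨ ℕₚ.+-monoʳ-≤ _ (∑ℕ-mono n (λ i → ℕₚ.≤-trans (diagonal n i) (⟦⟧≤1 (i ℕ.<? n)))) ⟩
      ∑∑ n (λ i j → ⟦ p? i j ⟧) ℕ.+ ∑ℕ n (λ i → 1)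
        ≡⟨ cong (∑∑ n (λ i j → ⟦ p? i j ⟧) ℕ.+_) (trans (∑ℕ-const n 1) (ℕₚ.*-identityʳ n)) ⟩
      ∑∑ n (λ i j → ⟦ p? i j ⟧) ℕ.+ n ∎
      where open ℕₚ.≤-Reasoning

  -- Replacing the shift `d` by 0 only discards solutions, and `i + j < l` already forces `j ≤ l`,
  -- so the order of the last two entries comes for free.
  count-lower : ∀ d n (Δ : Coloring n) → ∑ℕ n (solutions 0 n (extend Δ)) ≤ 2 ℕ.* count -[1+ d ] n Δ
  count-lower d n Δ = begin
    ∑ℕ n (solutions 0 n χ)
      ≤⟨ ∑ℕ-mono n (λ l → unordered≥ n (solution? 0 χ l) (solution-sym 0 χ l)) ⟩
    ∑ℕ n (λ l → 2 ℕ.* ∑∑ n (λ i j → ⟦ i ℕ.≤? j ×-dec solution? 0 χ l i j ⟧))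
      ≡⟨ ∑ℕ-*ˡ n 2 _ ⟩
    2 ℕ.* ∑ℕ n (λ l → ∑∑ n (λ i j → ⟦ i ℕ.≤? j ×-dec solution? 0 χ l i j ⟧))
      ≤⟨ ℕₚ.*-monoʳ-≤ 2 (∑ℕ-mono n (λ l → ∑∑-mono n (λ i j → 
           ⟦⟧-mono (i ℕ.≤? j ×-dec solution? 0 χ l i j) (i ℕ.≤? j ×-dec j ℕ.≤? l ×-dec solution? d χ l i j) (weaken l i j)))) ⟩
    2 ℕ.* ∑ℕ n (λ l → ∑∑ n (λ i j → ⟦ i ℕ.≤? j ×-dec j ℕ.≤? l ×-dec solution? d χ l i j ⟧))
      ≡⟨ cong (2 ℕ.*_) (∑ℕ-rotate n _) ⟨
    2 ℕ.* ∑ℕ n (λ i → ∑ℕ n (λ j → ∑ℕ n (λ l → ⟦ i ℕ.≤? j ×-dec j ℕ.≤? l ×-dec solution? d χ l i j ⟧)))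
      ≡⟨ cong (2 ℕ.*_) (count≡∑ d n Δ) ⟨
    2 ℕ.* count -[1+ d ] n Δ ∎
    where
    open ℕₚ.≤-Reasoning
    χ = extend Δ
    weaken : ∀ l i j → i ≤ j × Solution 0 χ l i j → i ≤ j × j ≤ l × Solution d χ l i j
    weaken l i j (i≤j , i+j<l+0 , same) =
      i≤j , ℕₚ.≤-trans (ℕₚ.m≤n+m j i) (ℕₚ.<⇒≤ i+j<l) , ℕₚ.<-≤-trans i+j<l (ℕₚ.m≤m+n l d) , same
      where
      i+j<l : i ℕ.+ j < l
      i+j<l = subst (_ <_) (ℕₚ.+-identityʳ l) i+j<l+0

  -- For an upper bound the condition `j ≤ l` may be dropped while `d` is kept. The `n * n` collects
  -- one diagonal of length `n` for each `l`.
  count-upper : ∀ d n (Δ : Coloring n) →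
                2 ℕ.* count -[1+ d ] n Δ ≤ ∑ℕ n (solutions d n (extend Δ)) ℕ.+ n ℕ.* n
  count-upper d n Δ = begin
    2 ℕ.* count -[1+ d ] n Δ
      ≡⟨ cong (2 ℕ.*_) (count≡∑ d n Δ) ⟩
    2 ℕ.* ∑ℕ n (λ i → ∑ℕ n (λ j → ∑ℕ n (λ l → ⟦ i ℕ.≤? j ×-dec j ℕ.≤? l ×-dec solution? d χ l i j ⟧)))
      ≡⟨ cong (2 ℕ.*_) (∑ℕ-rotate n _) ⟩
    2 ℕ.* ∑ℕ n (λ l → ∑∑ n (λ i j → ⟦ i ℕ.≤? j ×-dec j ℕ.≤? l ×-dec solution? d χ l i j ⟧))
      ≤⟨ ℕₚ.*-monoʳ-≤ 2 (∑ℕ-mono n (λ l → ∑∑-mono n (λ i j → 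
           ⟦⟧-mono (i ℕ.≤? j ×-dec j ℕ.≤? l ×-dec solution? d χ l i j) (i ℕ.≤? j ×-dec solution? d χ l i j)
             λ (i≤j , _ , s) → i≤j , s))) ⟩
    2 ℕ.* ∑ℕ n (λ l → ∑∑ n (λ i j → ⟦ i ℕ.≤? j ×-dec solution? d χ l i j ⟧))
      ≡⟨ ∑ℕ-*ˡ n 2 _ ⟨
    ∑ℕ n (λ l → 2 ℕ.* ∑∑ n (λ i j → ⟦ i ℕ.≤? j ×-dec solution? d χ l i j ⟧))
      ≤⟨ ∑ℕ-mono n (λ l → unordered≤ n (solution? d χ l) (solution-sym d χ l)) ⟩
    ∑ℕ n (λ l → solutions d n χ l ℕ.+ n)
      ≡⟨ ∑ℕ-+ n _ _ ⟩
    ∑ℕ n (solutions d n χ) ℕ.+ ∑ℕ n (λ _ → n)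
      ≡⟨ cong (∑ℕ n (solutions d n χ) ℕ.+_) (∑ℕ-const n n) ⟩
    ∑ℕ n (solutions d n χ) ℕ.+ n ℕ.* n ∎
    where
    open ℕₚ.≤-Reasoning
    χ = extend Δ

  -- The minimum over all colourings

  foldr-⊓-attained : ∀ {A : Set} (f : A → ℕ) x₀ xs → ∃[ x ] f x ≡ foldr _⊓_ (f x₀) (map f xs)
  foldr-⊓-attained f x₀ []       = x₀ , refl
  foldr-⊓-attained f x₀ (x ∷ xs) with foldr-⊓-attained f x₀ xs | ℕₚ.⊓-sel (f x) (foldr _⊓_ (f x₀) (map f xs))
  ... | _      | inj₁ eq = x , sym eq
  ... | y , fy | inj₂ eq = y , trans fy (sym eq)

  foldr-⊓-≤ : ∀ {e x xs} → x ∈ xs → foldr _⊓_ e xs ≤ x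
  foldr-⊓-≤ (here refl)  = ℕₚ.m⊓n≤m _ _
  foldr-⊓-≤ (there x∈xs) = ℕₚ.≤-trans (ℕₚ.m⊓n≤n _ _) (foldr-⊓-≤ x∈xs)

  M-attained : ∀ k n → ∃[ Δ ] count k n Δ ≡ M k n
  M-attained k n = foldr-⊓-attained (count k n) (λ _ → false) (allColorings n)

  allColorings-complete : ∀ n (χ : ℕ → Bool) → Any (λ Δ → ∀ i → Δ i ≡ χ (toℕ i)) (allColorings n)
  allColorings-complete zero    χ = here λ ()
  allColorings-complete (suc n) χ =
    Anyₚ.concatMap⁺ _ (Any.map first (allColorings-complete n (χ ∘ suc)))
    where
    first : ∀ {Δ : Coloring n} → (∀ i → Δ i ≡ χ (suc (toℕ i))) → Any _ _
    first eq with χ 0 in χ0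
    ... | false = here λ { Fin.zero → sym χ0 ; (Fin.suc i) → eq i }
    ... | true  = there (here λ { Fin.zero → sym χ0 ; (Fin.suc i) → eq i })

  extend-≡ : ∀ {n} (Δ : Coloring n) (χ : ℕ → Bool) → (∀ i → Δ i ≡ χ (toℕ i)) → ∀ {i} → i < n → extend Δ i ≡ χ i
  extend-≡ {suc n} Δ χ eq {zero}  _         = eq Fin.zero
  extend-≡ {suc n} Δ χ eq {suc i} (s≤s i<n) = extend-≡ (Δ ∘ Fin.suc) (χ ∘ suc) (eq ∘ Fin.suc) i<n

  -- There is no function extensionality, so a prescribed colouring is only met up to pointwise equality.
  M-≤ : ∀ k n (χ : ℕ → Bool) → ∃[ Δ ] M k n ≤ count k n Δ × (∀ {i} → i < n → extend Δ i ≡ χ i)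
  M-≤ k n χ with find (allColorings-complete n χ)
  ... | Δ , Δ∈ , eq = Δ , foldr-⊓-≤ (∈-map⁺ (count k n) Δ∈) , extend-≡ Δ χ eq

-- The count as a quadratic form

module _ where

  open import Data.Nat using (_≤_; _<_)
  open import Data.Integer using (+_; _+_; _*_; _-_; -_)
  open GroupProperties (AbelianGroup.group ℤₚ.+-0-abelianGroup) using () renaming (∙-cancelˡ to +-cancelˡ)
  open Summation ℤₚ.+-*-commutativeSemiring

  +-∑ℕ : ∀ n f → + ∑ℕ n f ≡ ∑ n (λ i → + f i)
  +-∑ℕ zero    f = refl
  +-∑ℕ (suc n) f = cong (_+ + f n) (+-∑ℕ n f)

  mono? : ∀ (χ : ℕ → Bool) i j l → Dec (χ i ≡ χ j × χ j ≡ χ l)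
  mono? χ i j l = (χ i Boolₚ.≟ χ j) ×-dec (χ j Boolₚ.≟ χ l)

  -- The ordered solutions of `i + j < l` below `n`, with the inequality moved into the ranges so
  -- that inner sums of signs become values of `S`.
  triangle : (ℕ → Bool) → ℕ → ℕ
  triangle χ n = ∑ℕ n (λ l → ∑ℕ l (λ i → ∑ℕ (l ∸ i) (λ j → ⟦ mono? χ i j l ⟧)))

  -- The freedom `m ≤ n` lets an interval of odd length lose its last point: reading a colouring
  -- from both ends needs even length.
  triangle≤solutions : ∀ {m n} χ → m ≤ n → triangle χ m ≤ ∑ℕ n (solutions 0 n χ)
  triangle≤solutions {m} {n} χ m≤n = ℕₚ.≤-trans
    (∑ℕ-mono< m λ l l<m → let l≤n = ℕₚ.<⇒≤ (ℕₚ.<-≤-trans l<m m≤n) in ℕₚ.≤-trans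
      (∑ℕ-mono< l λ i i<l → ℕₚ.≤-trans
        (∑ℕ-mono< (l ∸ i) λ j j<l∸i → ⟦⟧-mono (mono? χ i j l) (solution? 0 χ l i j) λ same →
          subst₂ _<_ (ℕₚ.+-comm j i) (sym (ℕₚ.+-identityʳ l)) (ℕₚ.m≤o∸n⇒m+n≤o (suc j) (ℕₚ.<⇒≤ i<l) j<l∸i) , same)
        (∑ℕ-extend _ (ℕₚ.≤-trans (ℕₚ.m∸n≤m l i) l≤n)))
      (∑ℕ-extend _ l≤n))
    (∑ℕ-extend _ m≤n)

  sign : Bool → ℤ
  sign b = if b then + 1 else -[1+ 0 ]

  signs : (ℕ → Bool) → ℕ → ℤ
  signs χ i = sign (χ i)

  -- This makes the count a quadratic form in the signs.
  4mono≡ : ∀ χ i j l → + 4 * + ⟦ mono? χ i j l ⟧ ≡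
    + 1 + sign (χ i) * sign (χ j) + sign (χ i) * sign (χ l) + sign (χ j) * sign (χ l)
  4mono≡ χ i j l with χ i | χ j | χ l
  ... | true  | true  | true  = refl
  ... | true  | true  | false = refl
  ... | true  | false | true  = refl
  ... | true  | false | false = refl
  ... | false | true  | true  = refl
  ... | false | true  | false = refl
  ... | false | false | true  = refl
  ... | false | false | false = refl

  2∑-tri : ∀ l → + 2 * ∑ l (λ i → + (l ∸ i)) ≡ + l * (+ 1 + + l)
  2∑-tri zero    = refl
  2∑-tri (suc l) = trans (cong (+ 2 *_) (∑-head l _))
    (trans (ℤₚ.*-distribˡ-+ (+ 2) (+ suc l) (∑ l (λ i → + (l ∸ i)))) (trans (cong (λ z → + 2 * + suc l + z) (2∑-tri l)) (step (+ l))))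
    where
    step : ∀ x → + 2 * (+ 1 + x) + x * (+ 1 + x) ≡ (+ 1 + x) * (+ 1 + (+ 1 + x))
    step = ℤ-Solver.solve-∀

  6∑∑-tri : ∀ n → + 6 * ∑ n (λ l → ∑ l (λ i → + (l ∸ i))) ≡ + n * + n * + n - + n
  6∑∑-tri zero    = refl
  6∑∑-tri (suc n) = trans (expand (∑ n (λ l → ∑ l (λ i → + (l ∸ i)))) (∑ n (λ i → + (n ∸ i)))) (trans (cong₂ (λ x y → x + + 3 * y) (6∑∑-tri n) (2∑-tri n)) (step (+ n)))
    where
    expand : ∀ x y → + 6 * (x + y) ≡ + 6 * x + + 3 * (+ 2 * y)
    expand = ℤ-Solver.solve-∀
    step : ∀ x → x * x * x - x + + 3 * (x * (+ 1 + x)) ≡ (+ 1 + x) * (+ 1 + x) * (+ 1 + x) - (+ 1 + x)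
    step = ℤ-Solver.solve-∀

  -- The partial sums S of the signs turn the quadratic form into ∑ₜ S(t) S(n−t) + 2 ∑ₜ S(t) (S(n) − S(t)).
  module QuadraticForm (σ : ℕ → ℤ) where

    S : ℕ → ℤ
    S n = ∑ n σ

    convolution : ℕ → ℤ
    convolution n = ∑ (suc n) (λ t → S t * S (n ∸ t))

    crossing : ℕ → ℤ
    crossing n = ∑ (suc n) (λ t → S t * (S n - S t))

    -- Passing to `suc n` adds `S t * σ (n ∸ t)` for each `t`, which turns `S (n ∸ t)` into
    -- `S (suc n ∸ t)`; the new term at `t = suc n` vanishes because `S 0` is 0.
    ∑-convolution : ∀ n → ∑ n (λ l → ∑ l (λ i → σ i * S (l ∸ i))) ≡ convolution n
    ∑-convolution zero    = refl
    ∑-convolution (suc n) = begin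
      ∑ n (λ l → ∑ l (λ i → σ i * S (l ∸ i))) + ∑ n (λ i → σ i * S (n ∸ i))
        ≡⟨ cong₂ _+_ (∑-convolution n) last ⟩
      convolution n + ∑ (suc n) (λ t → S t * σ (n ∸ t))
        ≡⟨ ∑-+ (suc n) _ _ ⟨
      ∑ (suc n) (λ t → S t * S (n ∸ t) + S t * σ (n ∸ t))
        ≡⟨ ∑-cong< (suc n) (λ t t<1+n → trans (sym (ℤₚ.*-distribˡ-+ (S t) _ _))
             (cong (λ x → S t * S x) (sym (ℕₚ.+-∸-assoc 1 (ℕₚ.≤-pred t<1+n))))) ⟩
      ∑ (suc n) (λ t → S t * S (suc n ∸ t))
        ≡⟨ ℤₚ.+-identityʳ _ ⟨
      ∑ (suc n) (λ t → S t * S (suc n ∸ t)) + + 0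
        ≡⟨ cong (λ z → ∑ (suc n) (λ t → S t * S (suc n ∸ t)) + z) (trans (cong (λ x → S (suc n) * S x) (ℕₚ.n∸n≡0 n)) (ℤₚ.*-zeroʳ (S (suc n)))) ⟨
      convolution (suc n) ∎
      where
      open ≡-Reasoning
      last : ∑ n (λ i → σ i * S (n ∸ i)) ≡ ∑ (suc n) (λ t → S t * σ (n ∸ t))
      last = begin
        ∑ n (λ i → σ i * S (n ∸ i))
          ≡⟨ ℤₚ.+-identityʳ _ ⟨
        ∑ n (λ i → σ i * S (n ∸ i)) + + 0
          ≡⟨ cong (λ z → ∑ n (λ i → σ i * S (n ∸ i)) + z) (trans (cong (λ x → σ n * S x) (ℕₚ.n∸n≡0 n)) (ℤₚ.*-zeroʳ (σ n))) ⟨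
        ∑ (suc n) (λ i → σ i * S (n ∸ i))
          ≡⟨ ∑-reverse n _ ⟩
        ∑ (suc n) (λ t → σ (n ∸ t) * S (n ∸ (n ∸ t)))
          ≡⟨ ∑-cong< (suc n) (λ t t<1+n → trans (ℤₚ.*-comm (σ (n ∸ t)) _)
               (cong (λ x → S x * σ (n ∸ t)) (ℕₚ.m∸[m∸n]≡n (ℕₚ.≤-pred t<1+n)))) ⟩
        ∑ (suc n) (λ t → S t * σ (n ∸ t)) ∎

    -- After exchanging the summations, `S t` is multiplied by the signs of index at least `t`,
    -- whose sum is `S n - S t`.
    ∑-crossing : ∀ n → ∑ n (λ l → σ l * ∑ (suc l) S) ≡ crossing n
    ∑-crossing zero    = refl
    ∑-crossing (suc n) = begin
      ∑ n (λ l → σ l * ∑ (suc l) S) + σ n * ∑ (suc n) S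
        ≡⟨ cong₂ _+_ (∑-crossing n) (sym (∑-*ˡ (suc n) (σ n) S)) ⟩
      crossing n + ∑ (suc n) (λ t → σ n * S t)
        ≡⟨ ∑-+ (suc n) _ _ ⟨
      ∑ (suc n) (λ t → S t * (S n - S t) + σ n * S t)
        ≡⟨ ∑-cong (suc n) (λ t → step (S t) (S n) (σ n)) ⟩
      ∑ (suc n) (λ t → S t * (S (suc n) - S t))
        ≡⟨ end (∑ (suc n) (λ t → S t * (S (suc n) - S t))) (S (suc n)) ⟩
      crossing (suc n) ∎
      where
      open ≡-Reasoning
      step : ∀ x y z → x * (y - x) + z * x ≡ x * (y + z - x)
      step = ℤ-Solver.solve-∀
      end : ∀ x y → x ≡ x + y * (y - y)
      end = ℤ-Solver.solve-∀

    ∑-rows : ∀ l → ∑ l (λ i → S (l ∸ i)) ≡ ∑ (suc l) S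
    ∑-rows zero    = refl
    ∑-rows (suc l) = begin
      ∑ (suc l) (λ i → S (suc l ∸ i))      ≡⟨ ∑-head l _ ⟩
      S (suc l) + ∑ l (λ i → S (l ∸ i))    ≡⟨ cong (λ z → S (suc l) + z) (∑-rows l) ⟩
      S (suc l) + ∑ (suc l) S              ≡⟨ ℤₚ.+-comm (S (suc l)) _ ⟩
      ∑ (suc (suc l)) S                    ∎
      where open ≡-Reasoning

    -- `σ i` enters `S t` for the `l ∸ i` values `i < t ≤ l`. Together with `∑-rows` this makes the
    -- two products involving the sign of `l` contribute equally, whence the factor 2 at `crossing`.
    ∑-columns : ∀ l → ∑ l (λ i → + (l ∸ i) * σ i) ≡ ∑ (suc l) S
    ∑-columns zero    = refl
    ∑-columns (suc l) = begin
      ∑ l (λ i → + (suc l ∸ i) * σ i) + + (suc l ∸ l) * σ l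
        ≡⟨ cong₂ _+_ (∑-cong< l (λ i i<l → cong (λ x → + x * σ i) (ℕₚ.+-∸-assoc 1 (ℕₚ.<⇒≤ i<l))))
                     (cong (λ x → + x * σ l) (ℕₚ.m+n∸n≡m 1 l)) ⟩
      ∑ l (λ i → + suc (l ∸ i) * σ i) + + 1 * σ l
        ≡⟨ cong₂ _+_ (∑-cong l (λ i → suc-* (+ (l ∸ i)) (σ i))) (ℤₚ.*-identityˡ (σ l)) ⟩
      ∑ l (λ i → + (l ∸ i) * σ i + σ i) + σ l
        ≡⟨ cong (_+ σ l) (∑-+ l _ _) ⟩
      ∑ l (λ i → + (l ∸ i) * σ i) + S l + σ l
        ≡⟨ cong (λ x → x + S l + σ l) (∑-columns l) ⟩
      ∑ (suc l) S + S l + σ l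
        ≡⟨ ℤₚ.+-assoc (∑ (suc l) S) (S l) (σ l) ⟩
      ∑ (suc (suc l)) S ∎
      where
      open ≡-Reasoning
      suc-* : ∀ x y → (+ 1 + x) * y ≡ x * y + y
      suc-* = ℤ-Solver.solve-∀

    count-row : ∀ x y c → ∑ c (λ j → + 1 + x * σ j + x * y + σ j * y) ≡
                          + c + x * S c + y * (+ c * x + S c)
    count-row x y zero    = base x y
      where
      base : ∀ x y → + 0 ≡ + 0 + x * + 0 + y * (+ 0 * x + + 0)
      base = ℤ-Solver.solve-∀
    count-row x y (suc c) = trans (cong (_+ (+ 1 + x * σ c + x * y + σ c * y)) (count-row x y c)) (step x y (+ c) (S c) (σ c))
      where
      step : ∀ x y c s z → c + x * s + y * (c * x + s) + (+ 1 + x * z + x * y + z * y) ≡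
                           (+ 1 + c) + x * (s + z) + y * ((+ 1 + c) * x + (s + z))
      step = ℤ-Solver.solve-∀

    count-slice : ∀ y l → ∑ l (λ i → ∑ (l ∸ i) (λ j → + 1 + σ i * σ j + σ i * y + σ j * y)) ≡
      ∑ l (λ i → + (l ∸ i)) + ∑ l (λ i → σ i * S (l ∸ i)) + + 2 * (y * ∑ (suc l) S)
    count-slice y l = begin
      ∑ l (λ i → ∑ (l ∸ i) (λ j → + 1 + σ i * σ j + σ i * y + σ j * y))
        ≡⟨ ∑-cong l (λ i → count-row (σ i) y (l ∸ i)) ⟩
      ∑ l (λ i → + (l ∸ i) + σ i * S (l ∸ i) + y * (+ (l ∸ i) * σ i + S (l ∸ i)))
        ≡⟨ ∑-+ l _ _ ⟩
      ∑ l (λ i → + (l ∸ i) + σ i * S (l ∸ i)) + ∑ l (λ i → y * (+ (l ∸ i) * σ i + S (l ∸ i)))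
        ≡⟨ cong₂ _+_ (∑-+ l _ _) (trans (∑-*ˡ l y _) (cong (y *_)
             (trans (∑-+ l _ _) (cong₂ _+_ (∑-columns l) (∑-rows l))))) ⟩
      ∑ l (λ i → + (l ∸ i)) + ∑ l (λ i → σ i * S (l ∸ i)) + y * (∑ (suc l) S + ∑ (suc l) S)
        ≡⟨ cong (λ z → ∑ l (λ i → + (l ∸ i)) + ∑ l (λ i → σ i * S (l ∸ i)) + z) (double y (∑ (suc l) S)) ⟩
      ∑ l (λ i → + (l ∸ i)) + ∑ l (λ i → σ i * S (l ∸ i)) + + 2 * (y * ∑ (suc l) S) ∎
      where
      open ≡-Reasoning
      double : ∀ y z → y * (z + z) ≡ + 2 * (y * z)
      double = ℤ-Solver.solve-∀

    count-form : ∀ n →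
      ∑ n (λ l → ∑ l (λ i → ∑ (l ∸ i) (λ j → + 1 + σ i * σ j + σ i * σ l + σ j * σ l))) ≡
      ∑ n (λ l → ∑ l (λ i → + (l ∸ i))) + convolution n + + 2 * crossing n
    count-form n = begin
      ∑ n (λ l → ∑ l (λ i → ∑ (l ∸ i) (λ j → + 1 + σ i * σ j + σ i * σ l + σ j * σ l)))
        ≡⟨ ∑-cong n (λ l → count-slice (σ l) l) ⟩
      ∑ n (λ l → ∑ l (λ i → + (l ∸ i)) + ∑ l (λ i → σ i * S (l ∸ i)) + + 2 * (σ l * ∑ (suc l) S))
        ≡⟨ ∑-+ n _ _ ⟩
      ∑ n (λ l → ∑ l (λ i → + (l ∸ i)) + ∑ l (λ i → σ i * S (l ∸ i))) + ∑ n (λ l → + 2 * (σ l * ∑ (suc l) S))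
        ≡⟨ cong₂ _+_ (trans (∑-+ n _ _) (cong (λ z → ∑ n (λ l → ∑ l (λ i → + (l ∸ i))) + z) (∑-convolution n)))
                     (trans (∑-*ˡ n (+ 2) _) (cong (+ 2 *_) (∑-crossing n))) ⟩
      ∑ n (λ l → ∑ l (λ i → + (l ∸ i))) + convolution n + + 2 * crossing n ∎
      where open ≡-Reasoning

    A B : ℕ → ℕ → ℤ
    A n t = S t + S (n ∸ t) - + 2 * S n
    B n t = S t - S (n ∸ t)

    W : ℕ → ℕ → ℤ
    W n t = A n t * A n t + + 3 * (B n t * B n t)

    -- Completing squares after symmetrising t ↔ n − t.
    squares : ∀ n → + 4 * (convolution n + + 2 * crossing n) + ∑ (suc n) (W n) ≡ + suc n * (+ 4 * (S n * S n))
    squares n = +-cancelˡ (∑ (suc n) φ) _ _ (begin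
      ∑ (suc n) φ + (+ 4 * (convolution n + + 2 * crossing n) + ∑ (suc n) (W n))
        ≡⟨ cong₂ _+_ (∑-reverse n φ) (cong (_+ ∑ (suc n) (W n)) (cong (+ 4 *_)
             (trans (cong (λ z → convolution n + z) (sym (∑-*ˡ (suc n) (+ 2) _))) (sym (∑-+ (suc n) _ _))))) ⟩
      ∑ (suc n) (λ t → φ (n ∸ t)) + (+ 4 * ∑ (suc n) (λ t → S t * S (n ∸ t) + + 2 * (S t * (S n - S t))) + ∑ (suc n) (W n))
        ≡⟨ cong (λ z → ∑ (suc n) (λ t → φ (n ∸ t)) + z) (trans (cong (_+ ∑ (suc n) (W n)) (sym (∑-*ˡ (suc n) (+ 4) _))) (sym (∑-+ (suc n) _ _))) ⟩
      ∑ (suc n) (λ t → φ (n ∸ t)) + ∑ (suc n) (λ t → + 4 * (S t * S (n ∸ t) + + 2 * (S t * (S n - S t))) + W n t)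
        ≡⟨ ∑-+ (suc n) _ _ ⟨
      ∑ (suc n) (λ t → φ (n ∸ t) + (+ 4 * (S t * S (n ∸ t) + + 2 * (S t * (S n - S t))) + W n t))
        ≡⟨ ∑-cong (suc n) (λ t → pointwise (S t) (S (n ∸ t)) (S n)) ⟩
      ∑ (suc n) (λ t → φ t + + 4 * (S n * S n))
        ≡⟨ ∑-+ (suc n) _ _ ⟩
      ∑ (suc n) φ + ∑ (suc n) (λ t → + 4 * (S n * S n))
        ≡⟨ cong (λ z → ∑ (suc n) φ + z) (const (suc n)) ⟩
      ∑ (suc n) φ + + suc n * (+ 4 * (S n * S n)) ∎)
      where
      open ≡-Reasoning
      -- `W` is symmetric in p and q, the crossing term is not. The sum of `φ` is unchanged under t
      -- ↔ n - t, so adding it to both sides moves half of the crossing term from p to q; after that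
      -- the identity holds termwise.
      φ : ℕ → ℤ
      φ t = + 4 * (S n * S t - S t * S t)
      pointwise : ∀ p q m → + 4 * (m * q - q * q) +
        (+ 4 * (p * q + + 2 * (p * (m - p))) +
          ((p + q - + 2 * m) * (p + q - + 2 * m) + + 3 * ((p - q) * (p - q)))) ≡
        + 4 * (m * p - p * p) + + 4 * (m * m)
      pointwise = ℤ-Solver.solve-∀
      const : ∀ k → ∑ k (λ t → + 4 * (S n * S n)) ≡ + k * (+ 4 * (S n * S n))
      const zero    = refl
      const (suc k) = trans (cong (_+ + 4 * (S n * S n)) (const k)) (step (+ k) (+ 4 * (S n * S n)))
        where
        step : ∀ k x → k * x + x ≡ (+ 1 + k) * x
        step = ℤ-Solver.solve-∀

    -- The reversal t ↔ n - t fixes `A` and negates `B`, so `W` is symmetric about the midpoint `N`,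
    -- the only index without a partner.
    W-fold : ∀ N → ∑ (suc (N ℕ.+ N)) (W (N ℕ.+ N)) ≡ + 2 * ∑ N (W (N ℕ.+ N)) + W (N ℕ.+ N) N
    W-fold N = begin
      ∑ (suc (N ℕ.+ N)) w
        ≡⟨ cong (λ k → ∑ k w) (ℕₚ.+-suc N N) ⟨
      ∑ (N ℕ.+ suc N) w
        ≡⟨ ∑-split N (suc N) w ⟩
      ∑ N w + ∑ (suc N) (λ i → w (N ℕ.+ i))
        ≡⟨ cong (λ z → ∑ N w + z) (∑-reverse N _) ⟩
      ∑ N w + ∑ (suc N) (λ i → w (N ℕ.+ (N ∸ i)))
        ≡⟨ cong (λ z → ∑ N w + z) (∑-cong< (suc N) λ i i<1+N → mirror i (ℕₚ.≤-pred i<1+N)) ⟩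
      ∑ N w + (∑ N w + w N)
        ≡⟨ double (∑ N w) (w N) ⟩
      + 2 * ∑ N w + w N ∎
      where
      open ≡-Reasoning
      w = W (N ℕ.+ N)
      double : ∀ x y → x + (x + y) ≡ + 2 * x + y
      double = ℤ-Solver.solve-∀
      mirror : ∀ i → i ≤ N → w (N ℕ.+ (N ∸ i)) ≡ w i
      mirror i i≤N
        rewrite sym (ℕₚ.+-∸-assoc N i≤N) | ℕₚ.m∸[m∸n]≡n (ℕₚ.≤-trans i≤N (ℕₚ.m≤m+n N N))
        = symmetric (S i) (S (N ℕ.+ N ∸ i)) (S (N ℕ.+ N))
        where
        symmetric : ∀ p q m →
          (q + p - + 2 * m) * (q + p - + 2 * m) + + 3 * ((q - p) * (q - p)) ≡
          (p + q - + 2 * m) * (p + q - + 2 * m) + + 3 * ((p - q) * (p - q))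
        symmetric = ℤ-Solver.solve-∀

  4triangle : ∀ χ n → + 4 * + triangle χ n ≡
    ∑ n (λ l → ∑ l (λ i → ∑ (l ∸ i) (λ j →
      + 1 + sign (χ i) * sign (χ j) + sign (χ i) * sign (χ l) + sign (χ j) * sign (χ l))))
  4triangle χ n =
    trans (cong (+ 4 *_) (+-∑ℕ n _)) (trans (sym (∑-*ˡ n (+ 4) _)) (∑-cong n λ l →
    trans (cong (+ 4 *_) (+-∑ℕ l _)) (trans (sym (∑-*ˡ l (+ 4) _)) (∑-cong l λ i →
    trans (cong (+ 4 *_) (+-∑ℕ (l ∸ i) _)) (trans (sym (∑-*ˡ (l ∸ i) (+ 4) _)) (∑-cong (l ∸ i) λ j →
    4mono≡ χ i j l))))))

  -- The factor is 48 = 4 · 12: the 4 belongs to the indicator, and 12 clears the 6 of the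
  -- tetrahedral sum and the 4 of the completed squares.
  triangle-squares : ∀ (χ : ℕ → Bool) (N : ℕ) → let open QuadraticForm (signs χ); n = N ℕ.+ N in
    + 48 * + triangle χ n + + 3 * (+ 2 * ∑ N (W n) + W n N) ≡
    + 2 * (+ n * + n * + n - + n) + + 12 * (+ suc n * (S n * S n))
  triangle-squares χ N = begin
    + 48 * + triangle χ n + + 3 * (+ 2 * ∑ N (W n) + W n N)
      ≡⟨ cong (λ x → + 48 * + triangle χ n + + 3 * x) (W-fold N) ⟨
    + 48 * + triangle χ n + + 3 * ∑ (suc n) (W n)
      ≡⟨ regroup₁ (+ triangle χ n) (∑ (suc n) (W n)) ⟩
    + 12 * (+ 4 * + triangle χ n) + + 3 * ∑ (suc n) (W n)
      ≡⟨ cong (λ x → + 12 * x + + 3 * ∑ (suc n) (W n)) (trans (4triangle χ n) (count-form n)) ⟩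
    + 12 * (τ + convolution n + + 2 * crossing n) + + 3 * ∑ (suc n) (W n)
      ≡⟨ regroup₂ τ (convolution n) (crossing n) (∑ (suc n) (W n)) ⟩
    + 2 * (+ 6 * τ) + + 3 * (+ 4 * (convolution n + + 2 * crossing n) + ∑ (suc n) (W n))
      ≡⟨ cong₂ (λ x y → + 2 * x + + 3 * y) (6∑∑-tri n) (squares n) ⟩
    + 2 * (+ n * + n * + n - + n) + + 3 * (+ suc n * (+ 4 * (S n * S n)))
      ≡⟨ cong (λ z → + 2 * (+ n * + n * + n - + n) + z) (regroup₃ (+ suc n) (S n * S n)) ⟩
    + 2 * (+ n * + n * + n - + n) + + 12 * (+ suc n * (S n * S n)) ∎
    where
    open ≡-Reasoning
    open QuadraticForm (signs χ)
    n = N ℕ.+ N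
    τ = ∑ n (λ l → ∑ l (λ i → + (l ∸ i)))
    regroup₁ : ∀ x y → + 48 * x + + 3 * y ≡ + 12 * (+ 4 * x) + + 3 * y
    regroup₁ = ℤ-Solver.solve-∀
    regroup₂ : ∀ t p e w → + 12 * (t + p + + 2 * e) + + 3 * w ≡ + 2 * (+ 6 * t) + + 3 * (+ 4 * (p + + 2 * e) + w)
    regroup₂ = ℤ-Solver.solve-∀
    regroup₃ : ∀ x y → + 3 * (x * (+ 4 * y)) ≡ + 12 * (x * y)
    regroup₃ = ℤ-Solver.solve-∀

-- The extremal problem for lattice paths

module _ where

  open import Data.Nat using (_+_; _*_; _≤_; _≤?_)

  -- Polynomial inequalities over ℕ are reduced to ring identities: s is the slack.
  ≤-by : ∀ {l r x y} s → l ≤ r → x + r + s ≡ y + l → x ≤ y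
  ≤-by {l} {r} {x} {y} s l≤r eq = ℕₚ.+-cancelʳ-≤ l x y (begin
    x + l     ≤⟨ ℕₚ.+-monoʳ-≤ x l≤r ⟩
    x + r     ≤⟨ ℕₚ.m≤m+n (x + r) s ⟩
    x + r + s ≡⟨ eq ⟩
    y + l     ∎)
    where open ℕₚ.≤-Reasoning

  ≤-slack : ∀ {x y} s → x + s ≡ y → x ≤ y
  ≤-slack {x} s refl = ℕₚ.m≤m+n x s

  sq-mono : ∀ {x y} → x ≤ y → x * x ≤ y * y
  sq-mono h = ℕₚ.*-mono-≤ h h

  cube-mono : ∀ {x y} → x ≤ y → x * x * x ≤ y * y * y
  cube-mono h = ℕₚ.*-mono-≤ (sq-mono h) h

  -- The left Riemann sum of the increasing function 3x² on [ν, ν + X] is at most its integral.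
  ∑-squares≤ : ∀ ν X → 3 * ∑ℕ X (λ x → (ν + x) * (ν + x)) + ν * ν * ν ≤ (ν + X) * (ν + X) * (ν + X)
  ∑-squares≤ ν zero    rewrite ℕₚ.+-identityʳ ν = ℕₚ.≤-refl
  ∑-squares≤ ν (suc X) rewrite ℕₚ.+-suc ν X =
    ≤-by (3 * (ν + X) + 1) (∑-squares≤ ν X) (identity (∑ℕ X _) (ν + X) (ν * ν * ν))
    where
    identity : ∀ s y c → 3 * (s + y * y) + c + y * y * y + (3 * y + 1) ≡
                         (1 + y) * (1 + y) * (1 + y) + (3 * s + c)
    identity = ℕ-Solver.solve-∀

  ∑-squares-down≤ : ∀ m → 3 * ∑ℕ m (λ i → (m ∸ i) * (m ∸ i)) ≤ (1 + m) * (1 + m) * (1 + m)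
  ∑-squares-down≤ zero    = z≤n
  ∑-squares-down≤ (suc m) rewrite ∑ℕ-head m (λ i → (suc m ∸ i) * (suc m ∸ i)) =
    ≤-by (3 * m + 4) (∑-squares-down≤ m) (identity (∑ℕ m _) m)
    where
    identity : ∀ s m → 3 * ((1 + m) * (1 + m) + s) + (1 + m) * (1 + m) * (1 + m) + (3 * m + 4) ≡
                       (2 + m) * (2 + m) * (2 + m) + 3 * s
    identity = ℕ-Solver.solve-∀

  ∑-ramp≤ : ∀ c X → 4 * X ≤ c → ∑ℕ X (λ x → c ∸ 4 * x) + 2 * (X * X) ≤ X * c + 2 * X
  ∑-ramp≤ c zero    _    = z≤n
  ∑-ramp≤ c (suc X) 4+4X≤c =
    ≤-by 0 (ℕₚ.+-mono-≤ (∑-ramp≤ c X 4X≤c) (ℕₚ.≤-reflexive (ℕₚ.m∸n+n≡m 4X≤c)))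
      (identity (∑ℕ X _) X c (c ∸ 4 * X))
    where
    4X≤c : 4 * X ≤ c
    4X≤c = ℕₚ.≤-trans (ℕₚ.*-monoʳ-≤ 4 (ℕₚ.n≤1+n X)) 4+4X≤c
    identity : ∀ s X c d → s + d + 2 * ((1 + X) * (1 + X)) + (X * c + 2 * X + c) + 0 ≡
                           (1 + X) * c + 2 * (1 + X) + (s + 2 * (X * X) + (d + 4 * X))
    identity = ℕ-Solver.solve-∀

  -- A bound independent of `X`: the whole area under the ramp is c²/8 up to lower order. It
  -- replaces `∑-ramp≤` once the subtraction truncates.
  ∑-ramp≤² : ∀ X c → 8 * ∑ℕ X (λ x → c ∸ 4 * x) ≤ (c + 4) * (c + 4)
  ∑-ramp≤² zero    c = z≤n
  ∑-ramp≤² (suc X) c = begin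
    8 * ∑ℕ (suc X) (λ x → c ∸ 4 * x)
      ≡⟨ cong (8 *_) (∑ℕ-head X _) ⟩
    8 * (c + ∑ℕ X (λ x → c ∸ 4 * suc x))
      ≡⟨ cong (λ s → 8 * (c + s)) (∑ℕ-cong X λ x →
           trans (cong (c ∸_) (ℕₚ.*-suc 4 x)) (sym (ℕₚ.∸-+-assoc c 4 (4 * x)))) ⟩
    8 * (c + ∑ℕ X (λ x → c ∸ 4 ∸ 4 * x))
      ≡⟨ ℕₚ.*-distribˡ-+ 8 c _ ⟩
    8 * c + 8 * ∑ℕ X (λ x → c ∸ 4 ∸ 4 * x)
      ≤⟨ ℕₚ.+-monoʳ-≤ (8 * c) (∑-ramp≤² X (c ∸ 4)) ⟩
    8 * c + (c ∸ 4 + 4) * (c ∸ 4 + 4)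
      ≤⟨ last (ℕₚ.≤-total c 4) ⟩
    (c + 4) * (c + 4) ∎
    where
    open ℕₚ.≤-Reasoning
    small : ∀ c → 8 * c + 16 + c * c ≡ (c + 4) * (c + 4)
    small = ℕ-Solver.solve-∀
    large : ∀ c → 8 * c + c * c + 16 ≡ (c + 4) * (c + 4)
    large = ℕ-Solver.solve-∀
    last : c ≤ 4 ⊎ 4 ≤ c → 8 * c + (c ∸ 4 + 4) * (c ∸ 4 + 4) ≤ (c + 4) * (c + 4)
    last (inj₁ c≤4) rewrite ℕₚ.m≤n⇒m∸n≡0 c≤4 = ≤-slack (c * c) (small c)
    last (inj₂ 4≤c) rewrite ℕₚ.m∸n+n≡m 4≤c = ≤-slack 16 (large c)

  module Staircase (step : ℕ → Bool) where

    a b : ℕ → ℕ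
    a zero    = 0
    a (suc t) = if step t then suc (a t) else a t
    b zero    = 0
    b (suc t) = if step t then b t else suc (b t)

    a+b≡t : ∀ t → a t + b t ≡ t
    a+b≡t zero    = refl
    a+b≡t (suc t) with step t
    ... | true  = cong suc (a+b≡t t)
    ... | false = trans (ℕₚ.+-suc (a t) (b t)) (cong suc (a+b≡t t))

    b-step : ∀ t → b t ≤ b (suc t)
    b-step t with step t
    ... | true  = ℕₚ.≤-refl
    ... | false = ℕₚ.n≤1+n (b t)

    -- Summation by parts along the staircase: ∑ f over the b-steps equals
    -- b f(a) minus the increments of f at the a-steps, weighted by b.
    staircase-∑≤ : (f g K : ℕ → ℕ) (L : ℕ) →
      (∀ x y → y ≤ L → g y + y * f x ≤ y * f (suc x) + K x) →
      ∀ t → b t ≤ L →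
      ∑ℕ t (λ τ → f (a τ) + g (b τ)) ≤ ∑ℕ (a t) f + ∑ℕ (b t) g + b t * f (a t) + ∑ℕ (a t) K
    staircase-∑≤ f g K L h zero    _ = z≤n
    staircase-∑≤ f g K L h (suc t) b≤L
      with ih ← staircase-∑≤ f g K L h t (ℕₚ.≤-trans (b-step t) b≤L) | step t
    -- An a-step raises `b * f a` by `b` times the increment of `f`; by `h` this and `K` pay for the
    -- new `g (b t)`. A b-step is exact, since `b * f a` then grows by precisely `f (a t)`.
    ... | true  = ≤-by 0 (ℕₚ.+-mono-≤ ih (h (a t) (b t) b≤L))
          (identity (∑ℕ t _) (f (a t)) (g (b t)) (∑ℕ (a t) f) (∑ℕ (b t) g) (b t * f (a t)) (∑ℕ (a t) K)
            (b t * f (suc (a t))) (K (a t)))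
      where
      identity : ∀ s u v F G w k w′ k′ → s + (u + v) + (F + G + w + k + (w′ + k′)) + 0 ≡
        F + u + G + w′ + (k + k′) + (s + (v + w))
      identity = ℕ-Solver.solve-∀
    ... | false = ≤-by 0 ih
          (identity (∑ℕ t _) (f (a t)) (g (b t)) (∑ℕ (a t) f) (∑ℕ (b t) g) (b t) (∑ℕ (a t) K))
      where
      identity : ∀ s u v F G b k → s + (u + v) + (F + G + b * u + k) + 0 ≡
        F + (G + v) + (1 + b) * u + k + s
      identity = ℕ-Solver.solve-∀

  module Optimisation (ν e : ℕ) where

    -- f and g bound A² and 3B² in terms of the numbers x of a-steps and y of b-steps made so far.
    -- The exchange inequality is convex in y for 2y ≤ e, so K only has to cover y = 0 and y = e/2.
    β f g K : ℕ → ℕ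
    β y = (ν + y) ⊓ (ν + e ∸ y)
    f x = 4 * ((ν + x) * (ν + x))
    g y = 12 * (β y * β y)
    K x = 12 * (ν * ν) + e * (8 * ν + 3 * e ∸ 4 * x)

    -- One a-step increases `f` by 4 (2ν + 2x + 1). For 2y ≤ e, using β y ≤ ν + y, the excess of
    -- `g y` over 12ν² and y such increments is at most 2y (8ν + 6y - 4x), which yields the second
    -- term of `K`. The first term 12ν² is `g 0`, paid while `B` waits. Past the middle β y ≤ ν +
    -- e/2 caps `g`, while y times the increment keeps growing.
    exchange : ∀ x y → y ≤ ν + e → g y + y * f x ≤ y * f (suc x) + K x
    exchange x y y≤L with 2 * y ≤? e
    ... | yes 2y≤e with r ← e ∸ 2 * y | refl ← ℕₚ.m+[n∸m]≡n 2y≤e =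
      ℕₚ.≤-trans (ℕₚ.+-monoˡ-≤ (y * f x) (ℕₚ.*-monoʳ-≤ 12 (sq-mono (ℕₚ.m⊓n≤m (ν + y) _))))
        (≤-by (6 * y * r + 4 * y + r * k) (ℕₚ.*-monoʳ-≤ (2 * y) (ℕₚ.m≤n+m∸n (8 * ν + 3 * e) (4 * x)))
          (identity ν x y r k))
      where
      k = 8 * ν + 3 * e ∸ 4 * x
      identity : ∀ ν x y r k →
        12 * ((ν + y) * (ν + y)) + y * (4 * ((ν + x) * (ν + x))) + 2 * y * (4 * x + k) + (6 * y * r + 4 * y + r * k) ≡
        y * (4 * ((ν + (1 + x)) * (ν + (1 + x)))) + (12 * (ν * ν) + (2 * y + r) * k) + 2 * y * (8 * ν + 3 * (2 * y + r))
      identity = ℕ-Solver.solve-∀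
    ... | no 2y≰e =
      ≤-by (4 * y) (ℕₚ.+-mono-≤ (ℕₚ.*-monoʳ-≤ 3 (sq-mono 2β≤))
                   (ℕₚ.+-mono-≤ (ℕₚ.*-monoʳ-≤ e (ℕₚ.m≤n+m∸n (8 * ν + 3 * e) (4 * x)))
                                (ℕₚ.*-monoˡ-≤ (4 * (ν + x)) e≤2y)))
        (identity ν e x y (8 * ν + 3 * e ∸ 4 * x) (β y))
      where
      e≤2y : e ≤ 2 * y
      e≤2y = ℕₚ.<⇒≤ (ℕₚ.≰⇒> 2y≰e)
      2β≤ : 2 * β y ≤ 2 * ν + e
      2β≤ = ℕₚ.≤-trans (ℕₚ.*-monoʳ-≤ 2 (ℕₚ.m⊓n≤n (ν + y) _))
        (≤-by 0 (ℕₚ.+-mono-≤ e≤2y (ℕₚ.≤-reflexive (cong (2 *_) (ℕₚ.m∸n+n≡m y≤L)))) (double ν e y (ν + e ∸ y)))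
        where
        double : ∀ ν e y z → 2 * z + (2 * y + 2 * (ν + e)) + 0 ≡ 2 * ν + e + (e + 2 * (z + y))
        double = ℕ-Solver.solve-∀
      identity : ∀ ν e x y k z →
        12 * (z * z) + y * (4 * ((ν + x) * (ν + x)))
          + (3 * ((2 * ν + e) * (2 * ν + e)) + (e * (4 * x + k) + 2 * y * (4 * (ν + x)))) + 4 * y ≡
        y * (4 * ((ν + (1 + x)) * (ν + (1 + x)))) + (12 * (ν * ν) + e * k)
          + (3 * (2 * z * (2 * z)) + (e * (8 * ν + 3 * e) + e * (4 * (ν + x))))
      identity = ℕ-Solver.solve-∀

    -- β rises for ⌊e/2⌋ steps and falls to 0 over the remaining ν + ⌈e/2⌉, so both sums of squares
    -- are compared with the cube of the peak ν + e/2. Doubling avoids halving an odd e; the `4`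
    -- absorbs the rounding and the off-by-one of the descending sum.
    ∑g≤ : 2 * ∑ℕ (ν + e) g + 8 * (ν * ν * ν) ≤
          (2 * ν + e) * (2 * ν + e) * (2 * ν + e) + (2 * ν + e + 4) * (2 * ν + e + 4) * (2 * ν + e + 4)
    ∑g≤ = begin
      2 * ∑ℕ (ν + e) g + 8 * (ν * ν * ν)
        ≡⟨ cong (λ k → 2 * ∑ℕ k g + 8 * (ν * ν * ν)) L≡ ⟩
      2 * ∑ℕ (j + (ν + r)) g + 8 * (ν * ν * ν)
        ≡⟨ cong (λ s → 2 * s + 8 * (ν * ν * ν)) (∑ℕ-split j (ν + r) g) ⟩
      2 * (∑ℕ j g + ∑ℕ (ν + r) (λ i → g (j + i))) + 8 * (ν * ν * ν)
        ≤⟨ ℕₚ.+-monoˡ-≤ (8 * (ν * ν * ν)) (ℕₚ.*-monoʳ-≤ 2 (ℕₚ.+-mono-≤ up down)) ⟩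
      2 * (12 * s + 12 * s′) + 8 * (ν * ν * ν)
        ≤⟨ ≤-by 0 (ℕₚ.+-mono-≤ (ℕₚ.*-monoʳ-≤ 8 (∑-squares≤ ν j)) (ℕₚ.*-monoʳ-≤ 8 (∑-squares-down≤ (ν + r))))
                  (regroup s s′ (ν * ν * ν) ((ν + j) * (ν + j) * (ν + j)) ((1 + (ν + r)) * (1 + (ν + r)) * (1 + (ν + r)))) ⟩
      8 * ((ν + j) * (ν + j) * (ν + j)) + 8 * ((1 + (ν + r)) * (1 + (ν + r)) * (1 + (ν + r)))
        ≡⟨ cong₂ _+_ (8*cube (ν + j)) (8*cube (1 + (ν + r))) ⟩
      2 * (ν + j) * (2 * (ν + j)) * (2 * (ν + j)) + 2 * (1 + (ν + r)) * (2 * (1 + (ν + r))) * (2 * (1 + (ν + r)))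
        ≤⟨ ℕₚ.+-mono-≤ (cube-mono low) (cube-mono high) ⟩
      (2 * ν + e) * (2 * ν + e) * (2 * ν + e) + (2 * ν + e + 4) * (2 * ν + e + 4) * (2 * ν + e + 4) ∎
      where
      open ℕₚ.≤-Reasoning
      j = ⌊ e /2⌋
      r = ⌈ e /2⌉
      j+r≡e : j + r ≡ e
      j+r≡e = ℕₚ.⌊n/2⌋+⌈n/2⌉≡n e
      s = ∑ℕ j (λ y → (ν + y) * (ν + y))
      s′ = ∑ℕ (ν + r) (λ i → (ν + r ∸ i) * (ν + r ∸ i))
      swap : ∀ ν j r → ν + (j + r) ≡ j + (ν + r)
      swap = ℕ-Solver.solve-∀
      L≡ : ν + e ≡ j + (ν + r)
      L≡ = trans (cong (ν +_) (sym j+r≡e)) (swap ν j r)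
      up : ∑ℕ j g ≤ 12 * s
      up = ℕₚ.≤-trans (∑ℕ-mono j (λ y → ℕₚ.*-monoʳ-≤ 12 (sq-mono (ℕₚ.m⊓n≤m (ν + y) _))))
                      (ℕₚ.≤-reflexive (∑ℕ-*ˡ j 12 _))
      shift : ∀ i → ν + e ∸ (j + i) ≡ ν + r ∸ i
      shift i = trans (cong (_∸ (j + i)) L≡) (ℕₚ.[m+n]∸[m+o]≡n∸o j (ν + r) i)
      down : ∑ℕ (ν + r) (λ i → g (j + i)) ≤ 12 * s′
      down = ℕₚ.≤-trans (∑ℕ-mono (ν + r) (λ i → ℕₚ.*-monoʳ-≤ 12 (sq-mono
               (ℕₚ.≤-trans (ℕₚ.m⊓n≤n (ν + (j + i)) _) (ℕₚ.≤-reflexive (shift i))))))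
                      (ℕₚ.≤-reflexive (∑ℕ-*ˡ (ν + r) 12 _))
      regroup : ∀ s s′ c u v → 2 * (12 * s + 12 * s′) + 8 * c + (8 * u + 8 * v) + 0 ≡
                               8 * u + 8 * v + (8 * (3 * s + c) + 8 * (3 * s′))
      regroup = ℕ-Solver.solve-∀
      8*cube : ∀ x → 8 * (x * x * x) ≡ 2 * x * (2 * x) * (2 * x)
      8*cube = ℕ-Solver.solve-∀
      low : 2 * (ν + j) ≤ 2 * ν + e
      low = ≤-by 0 (ℕₚ.+-mono-≤ (ℕₚ.⌊n/2⌋≤⌈n/2⌉ e) (ℕₚ.≤-reflexive j+r≡e)) (lemma ν j r e)
        where
        lemma : ∀ ν j r e → 2 * (ν + j) + (r + e) + 0 ≡ 2 * ν + e + (j + (j + r))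
        lemma = ℕ-Solver.solve-∀
      r≤1+j : r ≤ 1 + j
      r≤1+j = ℕₚ.⌊n/2⌋-mono (ℕₚ.n≤1+n (suc e))
      high : 2 * (1 + (ν + r)) ≤ 2 * ν + e + 4
      high = ≤-by 1 (ℕₚ.+-mono-≤ r≤1+j (ℕₚ.≤-reflexive j+r≡e)) (lemma ν j r e)
        where
        lemma : ∀ ν j r e → 2 * (1 + (ν + r)) + (1 + j + e) + 1 ≡ 2 * ν + e + 4 + (r + (j + r))
        lemma = ℕ-Solver.solve-∀

    -- At e = 0 the sixfold sum is 8N³ + 24νN² + 72ν²N - 56ν³ up to quadratic terms, so the claim is
    -- that for fixed N and ν a surplus of b-steps gains nothing in the cubic order. The cases
    -- distinguish whether the ramp in `K` reaches 0 within X steps; in both, the slack is a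
    -- polynomial with nonnegative coefficients whose cubic terms all contain e.
    total≤ : ∀ X → let N = X + ν + e in
      6 * (∑ℕ X f + ∑ℕ (ν + e) g + (ν + e) * f X + ∑ℕ X K) + 56 * (ν * ν * ν) ≤
      8 * (N * N * N) + 24 * (ν * (N * N)) + 72 * (ν * ν * N) + 192 * ((N + 1) * (N + 1))
    total≤ X = subst (_≤ rhs) (sym lhs≡) (bound (4 * X ≤? c))
      where
      N = X + ν + e
      c = 8 * ν + 3 * e
      s = ∑ℕ X (λ x → (ν + x) * (ν + x))
      G = ∑ℕ (ν + e) g
      q = ∑ℕ X (λ x → c ∸ 4 * x)
      rhs = 8 * (N * N * N) + 24 * (ν * (N * N)) + 72 * (ν * ν * N) + 192 * ((N + 1) * (N + 1))
      lhs = 6 * (4 * s + G + (ν + e) * (4 * ((ν + X) * (ν + X))) + (X * (12 * (ν * ν)) + e * q)) + 56 * (ν * ν * ν)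
      lhs≡ : 6 * (∑ℕ X f + ∑ℕ (ν + e) g + (ν + e) * f X + ∑ℕ X K) + 56 * (ν * ν * ν) ≡ lhs
      lhs≡ = cong₂ (λ F k → 6 * (F + G + (ν + e) * f X + k) + 56 * (ν * ν * ν))
        (∑ℕ-*ˡ X 4 _)
        (trans (∑ℕ-+ X _ _) (cong₂ _+_ (∑ℕ-const X _) (∑ℕ-*ˡ X e _)))
      bound : Dec (4 * X ≤ c) → lhs ≤ rhs
      bound (yes 4X≤c) = ≤-by
        (12 * X * X * e + 6 * X * e * e + 2 * e * e * e + 12 * e * e * ν + 48 * e * ν * ν + 192 * X * X
          + 372 * X * e + 384 * X * ν + 156 * e * e + 240 * e * ν + 48 * ν * ν + 384 * X + 240 * e + 96 * ν)
        (ℕₚ.+-mono-≤ (ℕₚ.*-monoʳ-≤ 8 (∑-squares≤ ν X))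
          (ℕₚ.+-mono-≤ (ℕₚ.*-monoʳ-≤ 3 ∑g≤) (ℕₚ.*-monoʳ-≤ (6 * e) (∑-ramp≤ c X 4X≤c))))
        (identity ν e X s G q)
        where
        identity : ∀ ν e X s G q →
          6 * (4 * s + G + (ν + e) * (4 * ((ν + X) * (ν + X))) + (X * (12 * (ν * ν)) + e * q)) + 56 * (ν * ν * ν)
          + (8 * ((ν + X) * (ν + X) * (ν + X)) + (3 * ((2 * ν + e) * (2 * ν + e) * (2 * ν + e) + (2 * ν + e + 4) * (2 * ν + e + 4) * (2 * ν + e + 4)) + 6 * e * (X * (8 * ν + 3 * e) + 2 * X)))
          + (12 * X * X * e + 6 * X * e * e + 2 * e * e * e + 12 * e * e * ν + 48 * e * ν * ν + 192 * X * X
          + 372 * X * e + 384 * X * ν + 156 * e * e + 240 * e * ν + 48 * ν * ν + 384 * X + 240 * e + 96 * ν)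
          ≡ 8 * ((X + ν + e) * (X + ν + e) * (X + ν + e)) + 24 * (ν * ((X + ν + e) * (X + ν + e))) + 72 * (ν * ν * (X + ν + e)) + 192 * ((X + ν + e + 1) * (X + ν + e + 1))
          + (8 * (3 * s + ν * ν * ν) + (3 * (2 * G + 8 * (ν * ν * ν)) + 6 * e * (q + 2 * (X * X))))
        identity = ℕ-Solver.solve-∀
      -- The area bound on the ramp alone would leave negative multiples of e³ and e²ν in the slack.
      -- The case hypothesis, weighted by 12e², trades part of the available e²X for them.
      bound (no 4X≰c) = ℕₚ.*-cancelˡ-≤ 4 (≤-by
        (48 * X * e * e + 192 * X * e * ν + 17 * e * e * e + 768 * X * X + 1536 * X * e + 1536 * X * ν
          + 552 * e * e + 768 * e * ν + 192 * ν * ν + 1536 * X + 912 * e + 384 * ν)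
        (ℕₚ.+-mono-≤ (ℕₚ.*-monoʳ-≤ 32 (∑-squares≤ ν X))
          (ℕₚ.+-mono-≤ (ℕₚ.*-monoʳ-≤ 12 ∑g≤) (ℕₚ.+-mono-≤ (ℕₚ.*-monoʳ-≤ (3 * e) (∑-ramp≤² X c))
            (ℕₚ.*-monoʳ-≤ (12 * (e * e)) (ℕₚ.<⇒≤ (ℕₚ.≰⇒> 4X≰c))))))
        (identity ν e X s G q))
        where
        identity : ∀ ν e X s G q →
          4 * (6 * (4 * s + G + (ν + e) * (4 * ((ν + X) * (ν + X))) + (X * (12 * (ν * ν)) + e * q)) + 56 * (ν * ν * ν))
          + (32 * ((ν + X) * (ν + X) * (ν + X)) + (12 * ((2 * ν + e) * (2 * ν + e) * (2 * ν + e) + (2 * ν + e + 4) * (2 * ν + e + 4) * (2 * ν + e + 4)) + (3 * e * ((8 * ν + 3 * e + 4) * (8 * ν + 3 * e + 4)) + 12 * (e * e) * (4 * X))))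
          + (48 * X * e * e + 192 * X * e * ν + 17 * e * e * e + 768 * X * X + 1536 * X * e + 1536 * X * ν
          + 552 * e * e + 768 * e * ν + 192 * ν * ν + 1536 * X + 912 * e + 384 * ν)
          ≡ 4 * (8 * ((X + ν + e) * (X + ν + e) * (X + ν + e)) + 24 * (ν * ((X + ν + e) * (X + ν + e))) + 72 * (ν * ν * (X + ν + e)) + 192 * ((X + ν + e + 1) * (X + ν + e + 1)))
          + (32 * (3 * s + ν * ν * ν) + (12 * (2 * G + 8 * (ν * ν * ν)) + (3 * e * (8 * q) + 12 * (e * e) * (8 * ν + 3 * e))))
        identity = ℕ-Solver.solve-∀

-- From colourings to lattice paths

module _ where

  open import Data.Nat using (_+_; _*_; _≤_; _<_)
  open import Data.Integer using (+_; ∣_∣)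
  open Summation ℤₚ.+-*-commutativeSemiring

  i*i≡∣i∣² : ∀ i → i ℤ.* i ≡ + (∣ i ∣ * ∣ i ∣)
  i*i≡∣i∣² (+ n)    = sym (ℤₚ.pos-* n n)
  i*i≡∣i∣² -[1+ n ] = refl

  module Folding (χ : ℕ → Bool) (N : ℕ) where

    open QuadraticForm (signs χ)

    n : ℕ
    n = N + N

    -- true for the steps that move A, false for those that move B
    step : ℕ → Bool
    step t = χ t xor χ (n ∸ suc t)

    open Staircase step

    falses : ℕ → ℕ
    falses k = ∑ℕ k (λ i → if χ i then 0 else 1)

    S≡ : ∀ k → S k ≡ + k ℤ.- + 2 ℤ.* + falses k
    S≡ zero    = refl
    S≡ (suc k) with χ k
    ... | true  = trans (cong (ℤ._+ + 1) (S≡ k)) (identity (+ k) (+ falses k))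
      where
      identity : ∀ x y → x ℤ.- + 2 ℤ.* y ℤ.+ + 1 ≡ + 1 ℤ.+ x ℤ.- + 2 ℤ.* (y ℤ.+ + 0)
      identity = ℤ-Solver.solve-∀
    ... | false = trans (cong (ℤ._+ -[1+ 0 ]) (S≡ k)) (identity (+ k) (+ falses k))
      where
      identity : ∀ x y → x ℤ.- + 2 ℤ.* y ℤ.+ ℤ.- + 1 ≡ + 1 ℤ.+ x ℤ.- + 2 ℤ.* (y ℤ.+ + 1)
      identity = ℤ-Solver.solve-∀

    ν : ℕ
    ν = ∣ + N ℤ.- + falses n ∣

    Sn≡ : S n ≡ + 2 ℤ.* (+ N ℤ.- + falses n)
    Sn≡ = trans (S≡ n) (identity (+ N) (+ falses n))
      where
      identity : ∀ x y → x ℤ.+ x ℤ.- + 2 ℤ.* y ≡ + 2 ℤ.* (x ℤ.- y)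
      identity = ℤ-Solver.solve-∀

    ∣Sn∣ : ∣ S n ∣ ≡ 2 * ν
    ∣Sn∣ = trans (cong ∣_∣ Sn≡) (ℤₚ.abs-* (+ 2) (+ N ℤ.- + falses n))

    private
      A₀ : ∣ A n 0 ∣ ≡ 2 * ν
      A₀ = trans (cong ∣_∣ (identity (S n))) (trans (ℤₚ.∣-i∣≡∣i∣ (S n)) ∣Sn∣)
        where
        identity : ∀ x → + 0 ℤ.+ x ℤ.- + 2 ℤ.* x ≡ ℤ.- x
        identity = ℤ-Solver.solve-∀

      B₀ : ∣ B n 0 ∣ ≡ 2 * ν
      B₀ = trans (cong ∣_∣ (ℤₚ.+-identityˡ (ℤ.- S n))) (trans (ℤₚ.∣-i∣≡∣i∣ (S n)) ∣Sn∣)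

      BN : ∣ B n N ∣ ≡ 0
      BN = cong ∣_∣ (trans (cong (λ k → S N ℤ.- S k) (ℕₚ.m+n∸n≡m N N)) (ℤₚ.+-inverseʳ (S N)))

      n∸t : ∀ {t} → t < N → n ∸ t ≡ suc (n ∸ suc t)
      n∸t t<N = ℕₚ.+-∸-assoc 1 (ℕₚ.<-≤-trans t<N (ℕₚ.m≤m+n N N))

      A-suc : ∀ {t} → t < N → A n (suc t) ≡ A n t ℤ.+ (sign (χ t) ℤ.- sign (χ (n ∸ suc t)))
      A-suc {t} t<N rewrite n∸t t<N = identity (S t) (S (n ∸ suc t)) (sign (χ t)) (sign (χ (n ∸ suc t))) (S n)
        where
        identity : ∀ p q x y m → p ℤ.+ x ℤ.+ q ℤ.- + 2 ℤ.* m ≡ p ℤ.+ (q ℤ.+ y) ℤ.- + 2 ℤ.* m ℤ.+ (x ℤ.- y)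
        identity = ℤ-Solver.solve-∀

      B-suc : ∀ {t} → t < N → B n (suc t) ≡ B n t ℤ.+ (sign (χ t) ℤ.+ sign (χ (n ∸ suc t)))
      B-suc {t} t<N rewrite n∸t t<N = identity (S t) (S (n ∸ suc t)) (sign (χ t)) (sign (χ (n ∸ suc t)))
        where
        identity : ∀ p q x y → p ℤ.+ x ℤ.- q ≡ p ℤ.- (q ℤ.+ y) ℤ.+ (x ℤ.+ y)
        identity = ℤ-Solver.solve-∀

      a-step : ∀ t → ∣ sign (χ t) ℤ.- sign (χ (n ∸ suc t)) ∣ + 2 * a t ≡ 2 * a (suc t)
      a-step t with χ t | χ (n ∸ suc t)
      ... | true  | true  = refl
      ... | true  | false = sym (ℕₚ.*-suc 2 (a t))
      ... | false | true  = sym (ℕₚ.*-suc 2 (a t))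
      ... | false | false = refl

      b-step′ : ∀ t → ∣ sign (χ t) ℤ.+ sign (χ (n ∸ suc t)) ∣ + 2 * b t ≡ 2 * b (suc t)
      b-step′ t with χ t | χ (n ∸ suc t)
      ... | true  | true  = sym (ℕₚ.*-suc 2 (b t))
      ... | true  | false = refl
      ... | false | true  = refl
      ... | false | false = sym (ℕₚ.*-suc 2 (b t))

    ∣A∣≤ : ∀ {t} → t ≤ N → ∣ A n t ∣ ≤ 2 * ν + 2 * a t
    ∣A∣≤ {zero}  _   = ℕₚ.≤-reflexive (trans A₀ (sym (ℕₚ.+-identityʳ (2 * ν))))
    ∣A∣≤ {suc t} t<N = begin
      ∣ A n (suc t) ∣                       ≡⟨ cong ∣_∣ (A-suc t<N) ⟩
      ∣ A n t ℤ.+ δ ∣                       ≤⟨ ℤₚ.∣i+j∣≤∣i∣+∣j∣ (A n t) δ ⟩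
      ∣ A n t ∣ + ∣ δ ∣                     ≤⟨ ℕₚ.+-monoˡ-≤ ∣ δ ∣ (∣A∣≤ (ℕₚ.<⇒≤ t<N)) ⟩
      2 * ν + 2 * a t + ∣ δ ∣               ≡⟨ identity (2 * ν) (2 * a t) ∣ δ ∣ ⟩
      2 * ν + (∣ δ ∣ + 2 * a t)             ≡⟨ cong (λ z → 2 * ν + z) (a-step t) ⟩
      2 * ν + 2 * a (suc t)                 ∎
      where
      open ℕₚ.≤-Reasoning
      δ = sign (χ t) ℤ.- sign (χ (n ∸ suc t))
      identity : ∀ x y z → x + y + z ≡ x + (z + y)
      identity = ℕ-Solver.solve-∀

    ∣B∣≤ : ∀ {t} → t ≤ N → ∣ B n t ∣ ≤ 2 * ν + 2 * b t
    ∣B∣≤ {zero}  _   = ℕₚ.≤-reflexive (trans B₀ (sym (ℕₚ.+-identityʳ (2 * ν))))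
    ∣B∣≤ {suc t} t<N = begin
      ∣ B n (suc t) ∣                       ≡⟨ cong ∣_∣ (B-suc t<N) ⟩
      ∣ B n t ℤ.+ δ ∣                       ≤⟨ ℤₚ.∣i+j∣≤∣i∣+∣j∣ (B n t) δ ⟩
      ∣ B n t ∣ + ∣ δ ∣                     ≤⟨ ℕₚ.+-monoˡ-≤ ∣ δ ∣ (∣B∣≤ (ℕₚ.<⇒≤ t<N)) ⟩
      2 * ν + 2 * b t + ∣ δ ∣               ≡⟨ identity (2 * ν) (2 * b t) ∣ δ ∣ ⟩
      2 * ν + (∣ δ ∣ + 2 * b t)             ≡⟨ cong (λ z → 2 * ν + z) (b-step′ t) ⟩
      2 * ν + 2 * b (suc t)                 ∎
      where
      open ℕₚ.≤-Reasoning
      δ = sign (χ t) ℤ.+ sign (χ (n ∸ suc t))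
      identity : ∀ x y z → x + y + z ≡ x + (z + y)
      identity = ℕ-Solver.solve-∀

    -- B vanishes at time N, so its size at time t is bounded by the remaining b-steps.
    ∣B∣+b≤ : ∀ k t → k + t ≡ N → ∣ B n t ∣ + 2 * b t ≤ 2 * b N
    ∣B∣+b≤ zero    t refl = ℕₚ.≤-reflexive (cong (_+ 2 * b N) BN)
    ∣B∣+b≤ (suc k) t k+t≡N = begin
      ∣ B n t ∣ + 2 * b t                        ≡⟨ cong (λ z → ∣ z ∣ + 2 * b t) back ⟩
      ∣ B n (suc t) ℤ.+ ℤ.- δ ∣ + 2 * b t        ≤⟨ ℕₚ.+-monoˡ-≤ (2 * b t) (ℤₚ.∣i+j∣≤∣i∣+∣j∣ (B n (suc t)) (ℤ.- δ)) ⟩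
      ∣ B n (suc t) ∣ + ∣ ℤ.- δ ∣ + 2 * b t      ≡⟨ cong (λ z → ∣ B n (suc t) ∣ + z + 2 * b t) (ℤₚ.∣-i∣≡∣i∣ δ) ⟩
      ∣ B n (suc t) ∣ + ∣ δ ∣ + 2 * b t          ≡⟨ ℕₚ.+-assoc ∣ B n (suc t) ∣ ∣ δ ∣ (2 * b t) ⟩
      ∣ B n (suc t) ∣ + (∣ δ ∣ + 2 * b t)        ≡⟨ cong (λ z → ∣ B n (suc t) ∣ + z) (b-step′ t) ⟩
      ∣ B n (suc t) ∣ + 2 * b (suc t)            ≤⟨ ∣B∣+b≤ k (suc t) (trans (ℕₚ.+-suc k t) k+t≡N) ⟩
      2 * b N                                    ∎
      where
      open ℕₚ.≤-Reasoning
      δ = sign (χ t) ℤ.+ sign (χ (n ∸ suc t))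
      t<N : t < N
      t<N = subst (t <_) k+t≡N (s≤s (ℕₚ.m≤n+m t k))
      identity : ∀ x y → x ≡ x ℤ.+ y ℤ.+ ℤ.- y
      identity = ℤ-Solver.solve-∀
      back : B n t ≡ B n (suc t) ℤ.+ ℤ.- δ
      back = trans (identity (B n t) δ) (cong (ℤ._+ ℤ.- δ) (sym (B-suc t<N)))

    -- At time 0 the preceding bound says that `B` has to come down from size 2ν to 0 in steps of
    -- size 2.
    ν≤bN : ν ≤ b N
    ν≤bN = ℕₚ.*-cancelˡ-≤ 2 (subst (_≤ 2 * b N) (trans (ℕₚ.+-identityʳ _) B₀) (∣B∣+b≤ N 0 (ℕₚ.+-identityʳ N)))

    -- `e` is the surplus of b-steps over the `ν` that are needed to bring `B` to 0.
    X e : ℕ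
    X = a N
    e = b N ∸ ν

    bN≡ : b N ≡ ν + e
    bN≡ = sym (ℕₚ.m+[n∸m]≡n ν≤bN)

    N≡ : N ≡ X + ν + e
    N≡ = trans (sym (a+b≡t N)) (trans (cong (λ z → X + z) bN≡) (sym (ℕₚ.+-assoc X ν e)))

    open Optimisation ν e

    w : ℕ → ℕ
    w t = ∣ A n t ∣ * ∣ A n t ∣ + 3 * (∣ B n t ∣ * ∣ B n t ∣)

    W≡ : ∀ t → W n t ≡ + w t
    W≡ t = cong₂ ℤ._+_ (i*i≡∣i∣² (A n t))
      (trans (cong (+ 3 ℤ.*_) (i*i≡∣i∣² (B n t))) (sym (ℤₚ.pos-* 3 (∣ B n t ∣ * ∣ B n t ∣))))

    w≤ : ∀ t → t ≤ N → w t ≤ f (a t) + g (b t)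
    w≤ t t≤N = ℕₚ.+-mono-≤
      (ℕₚ.≤-trans (sq-mono (∣A∣≤ t≤N)) (ℕₚ.≤-reflexive (four ν (a t))))
      (ℕₚ.≤-trans (ℕₚ.*-monoʳ-≤ 3 (sq-mono ∣B∣≤2β)) (ℕₚ.≤-reflexive (twelve (β (b t)))))
      where
      four : ∀ x y → (2 * x + 2 * y) * (2 * x + 2 * y) ≡ 4 * ((x + y) * (x + y))
      four = ℕ-Solver.solve-∀
      twelve : ∀ x → 3 * (2 * x * (2 * x)) ≡ 12 * (x * x)
      twelve = ℕ-Solver.solve-∀
      ∣B∣≤2β : ∣ B n t ∣ ≤ 2 * β (b t)
      ∣B∣≤2β = subst (∣ B n t ∣ ≤_) (sym (ℕₚ.*-distribˡ-⊓ 2 (ν + b t) (ν + e ∸ b t))) (ℕₚ.⊓-glb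
        (subst (∣ B n t ∣ ≤_) (sym (ℕₚ.*-distribˡ-+ 2 ν (b t))) (∣B∣≤ t≤N))
        (subst (∣ B n t ∣ ≤_) (trans (sym (ℕₚ.*-distribˡ-∸ 2 (b N) (b t))) (cong (λ k → 2 * (k ∸ b t)) bN≡))
          (ℕₚ.m+n≤o⇒m≤o∸n ∣ B n t ∣ (∣B∣+b≤ (N ∸ t) t (ℕₚ.m∸n+n≡m t≤N)))))

    ∑w≤ : ∑ℕ N w ≤ ∑ℕ X f + ∑ℕ (ν + e) g + (ν + e) * f X + ∑ℕ X K
    ∑w≤ = ℕₚ.≤-trans (∑ℕ-mono< N (λ t t<N → w≤ t (ℕₚ.<⇒≤ t<N)))
      (subst (λ L → ∑ℕ N (λ t → f (a t) + g (b t)) ≤ ∑ℕ X f + ∑ℕ L g + L * f X + ∑ℕ X K) bN≡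
        (staircase-∑≤ f g K (ν + e) exchange N (ℕₚ.≤-reflexive bN≡)))

    wN≤ : w N ≤ 4 * ((ν + X) * (ν + X))
    wN≤ = ℕₚ.≤-trans (w≤ N ℕₚ.≤-refl) (ℕₚ.≤-reflexive
      (trans (cong (λ z → f X + 12 * (z * z)) β≡0) (ℕₚ.+-identityʳ (f X))))
      where
      β≡0 : β (b N) ≡ 0
      β≡0 = trans (cong (λ k → (ν + b N) ⊓ k) (trans (cong (_∸ b N) (sym bN≡)) (ℕₚ.n∸n≡0 (b N)))) (ℕₚ.⊓-zeroʳ (ν + b N))

    R : ℕ
    R = triangle χ n

    counted : 48 * R + 3 * (2 * ∑ℕ N w + w N) + 2 * n ≡ 2 * (n * n * n) + 12 * (suc n * (4 * (ν * ν)))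
    counted = ℤₚ.+-injective (begin
      + (48 * R + 3 * (2 * ∑ℕ N w + w N) + 2 * n)
        ≡⟨ cong₂ (λ x y → x ℤ.+ + (3 * (2 * ∑ℕ N w + w N)) ℤ.+ y) (ℤₚ.pos-* 48 R) (ℤₚ.pos-* 2 n) ⟩
      + 48 ℤ.* + R ℤ.+ + (3 * (2 * ∑ℕ N w + w N)) ℤ.+ + 2 ℤ.* + n
        ≡⟨ cong (λ x → + 48 ℤ.* + R ℤ.+ x ℤ.+ + 2 ℤ.* + n) (trans (ℤₚ.pos-* 3 (2 * ∑ℕ N w + w N))
             (cong (λ x → + 3 ℤ.* (x ℤ.+ + w N)) (ℤₚ.pos-* 2 (∑ℕ N w)))) ⟩
      + 48 ℤ.* + R ℤ.+ + 3 ℤ.* (+ 2 ℤ.* + ∑ℕ N w ℤ.+ + w N) ℤ.+ + 2 ℤ.* + n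
        ≡⟨ cong₂ (λ x y → + 48 ℤ.* + R ℤ.+ + 3 ℤ.* (+ 2 ℤ.* x ℤ.+ y) ℤ.+ + 2 ℤ.* + n)
             (trans (+-∑ℕ N w) (∑-cong N (λ t → sym (W≡ t)))) (sym (W≡ N)) ⟩
      + 48 ℤ.* + R ℤ.+ + 3 ℤ.* (+ 2 ℤ.* ∑ N (W n) ℤ.+ W n N) ℤ.+ + 2 ℤ.* + n
        ≡⟨ cong (ℤ._+ + 2 ℤ.* + n) (triangle-squares χ N) ⟩
      + 2 ℤ.* (+ n ℤ.* + n ℤ.* + n ℤ.- + n) ℤ.+ + 12 ℤ.* (+ suc n ℤ.* (S n ℤ.* S n)) ℤ.+ + 2 ℤ.* + n
        ≡⟨ regroup (+ n) (+ 12 ℤ.* (+ suc n ℤ.* (S n ℤ.* S n))) ⟩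
      + 2 ℤ.* (+ n ℤ.* + n ℤ.* + n) ℤ.+ + 12 ℤ.* (+ suc n ℤ.* (S n ℤ.* S n))
        ≡⟨ cong₂ (λ x y → + 2 ℤ.* x ℤ.+ + 12 ℤ.* (+ suc n ℤ.* y)) cube Sn² ⟩
      + 2 ℤ.* + (n * n * n) ℤ.+ + 12 ℤ.* (+ suc n ℤ.* + (4 * (ν * ν)))
        ≡⟨ cong₂ ℤ._+_ (sym (ℤₚ.pos-* 2 (n * n * n)))
             (trans (cong (+ 12 ℤ.*_) (sym (ℤₚ.pos-* (suc n) (4 * (ν * ν))))) (sym (ℤₚ.pos-* 12 (suc n * (4 * (ν * ν)))))) ⟩
      + (2 * (n * n * n) + 12 * (suc n * (4 * (ν * ν)))) ∎)
      where
      open ≡-Reasoning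
      regroup : ∀ x y → + 2 ℤ.* (x ℤ.* x ℤ.* x ℤ.- x) ℤ.+ y ℤ.+ + 2 ℤ.* x ≡ + 2 ℤ.* (x ℤ.* x ℤ.* x) ℤ.+ y
      regroup = ℤ-Solver.solve-∀
      cube : + n ℤ.* + n ℤ.* + n ≡ + (n * n * n)
      cube = trans (cong (ℤ._* + n) (sym (ℤₚ.pos-* n n))) (sym (ℤₚ.pos-* (n * n) n))
      four : ∀ x → 2 * x * (2 * x) ≡ 4 * (x * x)
      four = ℕ-Solver.solve-∀
      Sn² : S n ℤ.* S n ≡ + (4 * (ν * ν))
      Sn² = trans (i*i≡∣i∣² (S n)) (cong +_ (trans (cong (λ x → x * x) ∣Sn∣) (four ν)))

  -- Up to O(N²), `counted` gives 48R = 16N³ + 96Nν² - 6 ∑ w, and `total≤` bounds 6 ∑ w by 8N³ +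
  -- 24νN² + 72ν²N - 56ν³. The difference 8N³ - 24νN² + 24ν²N + 56ν³ is 8 ((N - ν)³ + (2ν)³), which
  -- dictates the witnesses.
  cubes≤triangle : ∀ χ N → ∃[ a ] ∃[ u ] a + a + u ≡ N + N ×
    a * a * a + u * u * u ≤ 6 * triangle χ (N + N) + 26 * ((N + 1) * (N + 1))
  cubes≤triangle χ N = X + e , 2 * ν , trans (sides X ν e) (sym (cong₂ _+_ N≡ N≡)) ,
    subst (λ M → (X + e) * (X + e) * (X + e) + 2 * ν * (2 * ν) * (2 * ν) ≤ 6 * R + 26 * ((M + 1) * (M + 1))) (sym N≡)
      (ℕₚ.*-cancelˡ-≤ 8 (≤-by slack
        (ℕₚ.+-mono-≤ (ℕₚ.*-monoʳ-≤ 6 ∑w≤) (ℕₚ.+-mono-≤ (total≤ X)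
          (ℕₚ.+-mono-≤ (ℕₚ.*-monoʳ-≤ 3 wN≤) (ℕₚ.≤-reflexive (sym (subst Counted N≡ counted))))))
        (identity X ν e (∑ℕ N w) (w N) (∑ℕ X f + ∑ℕ (ν + e) g + (ν + e) * f X + ∑ℕ X K) R)))
    where
    open Folding χ N
    open Optimisation ν e
    Counted : ℕ → Set
    Counted M = 48 * R + 3 * (2 * ∑ℕ N w + w N) + 2 * (M + M) ≡
                2 * ((M + M) * (M + M) * (M + M)) + 12 * (suc (M + M) * (4 * (ν * ν)))
    sides : ∀ X ν e → X + e + (X + e) + 2 * ν ≡ X + ν + e + (X + ν + e)
    sides = ℕ-Solver.solve-∀
    slack : ℕ
    slack = 4 * X * X + 32 * X * e + 8 * X * ν + 16 * e * e + 32 * e * ν + 52 * ν * ν + 28 * X + 28 * e + 28 * ν + 16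
    identity : ∀ X ν e s w V R → let N = X + ν + e in
      8 * ((X + e) * (X + e) * (X + e) + 2 * ν * (2 * ν) * (2 * ν))
        + (6 * V + (8 * (N * N * N) + 24 * (ν * (N * N)) + 72 * (ν * ν * N) + 192 * ((N + 1) * (N + 1))
          + (3 * (4 * ((ν + X) * (ν + X))) + (48 * R + 3 * (2 * s + w) + 2 * (N + N)))))
        + (4 * X * X + 32 * X * e + 8 * X * ν + 16 * e * e + 32 * e * ν + 52 * ν * ν + 28 * X + 28 * e + 28 * ν + 16)
      ≡ 8 * (6 * R + 26 * ((N + 1) * (N + 1)))
        + (6 * s + (6 * V + 56 * (ν * ν * ν)
          + (3 * w + (2 * ((N + N) * (N + N) * (N + N)) + 12 * ((1 + (N + N)) * (4 * (ν * ν)))))))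
    identity = ℕ-Solver.solve-∀

-- Two-block colourings

module _ where

  open import Data.Nat using (_+_; _*_; _≤_; _<_; _≤?_)

  ∑-interval≤ : ∀ n lo hi {P : ℕ → Set} (p? : ∀ j → Dec (P j)) → (∀ j → P j → lo ≤ j × j < hi) →
                ∑ℕ n (λ j → ⟦ p? j ⟧) ≤ hi ∸ lo
  ∑-interval≤ zero    lo hi p? h = z≤n
  ∑-interval≤ (suc n) lo hi p? h = subst (_≤ hi ∸ lo) (sym (∑ℕ-head n _)) (cases lo hi h)
    where
    tail = ∑ℕ n (λ j → ⟦ p? (suc j) ⟧)
    cases : ∀ lo hi → (∀ j → _ → lo ≤ j × j < hi) → ⟦ p? 0 ⟧ + tail ≤ hi ∸ lo
    cases lo zero h = ℕₚ.≤-trans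
      (ℕₚ.+-mono-≤ (ℕₚ.≤-reflexive (⟦⟧≡0 (p? 0) (λ p → ℕₚ.n≮0 (proj₂ (h 0 p)))))
        (∑-interval≤ n 0 0 (p? ∘ suc) (λ j p → ⊥-elim (ℕₚ.n≮0 (proj₂ (h (suc j) p)))))) z≤n
    cases zero (suc hi) h =
      ℕₚ.+-mono-≤ (⟦⟧≤1 (p? 0)) (∑-interval≤ n 0 hi (p? ∘ suc) (λ j p → z≤n , ℕₚ.≤-pred (proj₂ (h (suc j) p))))
    cases (suc lo) (suc hi) h =
      ℕₚ.+-mono-≤ (ℕₚ.≤-reflexive (⟦⟧≡0 (p? 0) (λ p → ℕₚ.n≮0 (proj₁ (h 0 p)))))
        (∑-interval≤ n lo hi (p? ∘ suc)
          (λ j p → ℕₚ.≤-pred (proj₁ (h (suc j) p)) , ℕₚ.≤-pred (proj₂ (h (suc j) p))))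

  ∑-triangle≤ : ∀ n a c (h : ℕ → ℕ) → (∀ i → h i ≤ c ∸ i) → (∀ i → i < a → h i ≡ 0) →
                2 * ∑ℕ n h ≤ (c ∸ a) * (1 + (c ∸ a))
  ∑-triangle≤ zero    a c h h≤ h≡0 = z≤n
  ∑-triangle≤ (suc n) a c h h≤ h≡0 =
    subst (λ s → 2 * s ≤ (c ∸ a) * (1 + (c ∸ a))) (sym (∑ℕ-head n h)) (cases a c h≤ h≡0)
    where
    tail = ∑ℕ n (h ∘ suc)
    cases : ∀ a c → (∀ i → h i ≤ c ∸ i) → (∀ i → i < a → h i ≡ 0) → 2 * (h 0 + tail) ≤ (c ∸ a) * (1 + (c ∸ a))
    cases a zero h≤ h≡0 = ℕₚ.≤-trans (ℕₚ.*-monoʳ-≤ 2 (ℕₚ.+-monoˡ-≤ tail (h≤ 0)))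
      (ℕₚ.≤-trans (∑-triangle≤ n 0 0 (h ∘ suc)
        (λ i → ℕₚ.≤-trans (h≤ (suc i)) z≤n) (λ i ())) z≤n)
    cases zero (suc c) h≤ h≡0 =
      ≤-by 0 (ℕₚ.+-mono-≤ (ℕₚ.*-monoʳ-≤ 2 (h≤ 0)) (∑-triangle≤ n 0 c (h ∘ suc) (λ i → h≤ (suc i)) (λ i ())))
        (identity (h 0) tail c)
      where
      identity : ∀ x y c → 2 * (x + y) + (2 * (1 + c) + c * (1 + c)) + 0 ≡ (1 + c) * (1 + (1 + c)) + (2 * x + 2 * y)
      identity = ℕ-Solver.solve-∀
    cases (suc a) (suc c) h≤ h≡0 = subst (λ x → 2 * (x + tail) ≤ (c ∸ a) * (1 + (c ∸ a)))
      (sym (h≡0 0 (s≤s z≤n)))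
      (∑-triangle≤ n a c (h ∘ suc) (λ i → h≤ (suc i)) (λ i i<a → h≡0 (suc i) (s≤s i<a)))

  -- Subtracting `a` from both entries leaves a triangle of side `c ∸ (a + a)`; the truncation
  -- covers the case that no pair exists.
  pairs≤ : ∀ n a c {P : ℕ → ℕ → Set} (p? : ∀ i j → Dec (P i j)) →
           (∀ i j → P i j → a ≤ i × a ≤ j × i + j < c) →
           2 * ∑∑ n (λ i j → ⟦ p? i j ⟧) ≤ (c ∸ (a + a)) * (1 + (c ∸ (a + a)))
  pairs≤ n a c p? h = subst (λ y → 2 * ∑∑ n (λ i j → ⟦ p? i j ⟧) ≤ y * (1 + y)) (ℕₚ.∸-+-assoc c a a)
    (∑-triangle≤ n a (c ∸ a) _
      (λ i → ∑-interval≤′ i)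
      (λ i i<a → ℕₚ.n≤0⇒n≡0 (∑-interval≤ n 0 0 (p? i) (λ j p → ⊥-elim (ℕₚ.<⇒≱ i<a (proj₁ (h i j p)))))))
    where
    ∑-interval≤′ : ∀ i → ∑ℕ n (λ j → ⟦ p? i j ⟧) ≤ c ∸ a ∸ i
    ∑-interval≤′ i = subst (∑ℕ n (λ j → ⟦ p? i j ⟧) ≤_)
      (trans (ℕₚ.∸-+-assoc c i a) (trans (cong (c ∸_) (ℕₚ.+-comm i a)) (sym (ℕₚ.∸-+-assoc c a i))))
      (∑-interval≤ n a (c ∸ i) (p? i) λ j p → proj₁ (proj₂ (h i j p)) ,
        ℕₚ.m+n≤o⇒m≤o∸n (suc j) (subst (_≤ c) (cong suc (ℕₚ.+-comm i j)) (proj₂ (proj₂ (h i j p)))))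

  -- Twice the number of pairs of naturals with sum below `y`.
  pronic : ℕ → ℕ
  pronic y = y * (1 + y)

  ∑-pronic≤ : ∀ r d a → 3 * ∑ℕ r (λ i → pronic (i + d ∸ a)) ≤
    (1 + (r + d ∸ a)) * (1 + (r + d ∸ a)) * (1 + (r + d ∸ a))
  ∑-pronic≤ zero    d a = z≤n
  ∑-pronic≤ (suc r) d a with ℕₚ.≤-total a (r + d)
  ... | inj₁ a≤r+d rewrite ℕₚ.+-∸-assoc 1 a≤r+d =
    ≤-by (6 * (r + d ∸ a) + 7) (∑-pronic≤ r d a) (identity (∑ℕ r _) (r + d ∸ a))
    where
    identity : ∀ s x → 3 * (s + x * (1 + x)) + (1 + x) * (1 + x) * (1 + x) + (6 * x + 7) ≡
                       (1 + (1 + x)) * (1 + (1 + x)) * (1 + (1 + x)) + 3 * s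
    identity = ℕ-Solver.solve-∀
  ... | inj₂ r+d≤a with ih ← ∑-pronic≤ r d a rewrite ℕₚ.m≤n⇒m∸n≡0 r+d≤a =
    ℕₚ.≤-trans (ℕₚ.≤-reflexive (cong (3 *_) (ℕₚ.+-identityʳ (∑ℕ r (λ i → pronic (i + d ∸ a))))))
      (ℕₚ.≤-trans ih (cube-mono {1} {1 + (suc r + d ∸ a)} (s≤s z≤n)))

  twoBlock : ℕ → ℕ → Bool
  twoBlock a i = does (a ≤? i)

  -- For x₃ in the lower block the colours of the other two are ignored. For x₃ at offset a + i both
  -- others lie in the upper block, and cancelling `a` from each leaves pairs with sum below
  -- `i + d ∸ a`. Summed over the two blocks this gives the two cubes; `6 * (n * n)` comes from the
  -- diagonals.
  count-twoBlock≤ : ∀ d a u → let n = a + (a + u) in (Δ : Coloring n) →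
    (∀ {i} → i < n → extend Δ i ≡ twoBlock a i) →
    12 * count -[1+ d ] n Δ ≤
      (1 + (a + d)) * (1 + (a + d)) * (1 + (a + d)) + (1 + (u + d)) * (1 + (u + d)) * (1 + (u + d)) + 6 * (n * n)
  count-twoBlock≤ d a u Δ Δ≡ = ≤-by 0
    (ℕₚ.+-mono-≤ (ℕₚ.*-monoʳ-≤ 6 (count-upper d n Δ)) (ℕₚ.+-mono-≤ (ℕₚ.*-monoʳ-≤ 3 ∑sol≤)
      (ℕₚ.+-mono-≤ (∑-pronic≤ a d 0)
        (subst (λ y → 3 * t ≤ (1 + y) * (1 + y) * (1 + y)) shift (∑-pronic≤ (a + u) d a)))))
    (identity (count -[1+ d ] n Δ) (∑ℕ n sol) n s t
      ((1 + (a + d)) * (1 + (a + d)) * (1 + (a + d))) ((1 + (u + d)) * (1 + (u + d)) * (1 + (u + d))))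
    where
    n = a + (a + u)
    χ = extend Δ
    sol = solutions d n χ
    s = ∑ℕ a (λ l → pronic (l + d))
    t = ∑ℕ (a + u) (λ l → pronic (l + d ∸ a))
    identity : ∀ c σ n s t x y → 12 * c + (6 * (σ + n * n) + (3 * (s + t) + (x + y))) + 0 ≡
      x + y + 6 * (n * n) + (6 * (2 * c) + (3 * (2 * σ) + (3 * s + 3 * t)))
    identity = ℕ-Solver.solve-∀
    shift : a + u + d ∸ a ≡ u + d
    shift = trans (cong (_∸ a) (ℕₚ.+-assoc a u d)) (ℕₚ.m+n∸m≡n a (u + d))
    true⇒≥ : ∀ {i} → i < n → χ i ≡ true → a ≤ i
    true⇒≥ {i} i<n χi with a ≤? i
    ... | yes a≤i = a≤i
    ... | no a≰i with () ← trans (sym χi) (trans (Δ≡ i<n) (dec-false (a ≤? i) a≰i))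
    ≥⇒true : ∀ {i} → i < n → a ≤ i → χ i ≡ true
    ≥⇒true {i} i<n a≤i = trans (Δ≡ i<n) (dec-true (a ≤? i) a≤i)
    sol-low : ∀ l → 2 * sol l ≤ pronic (l + d)
    sol-low l = pairs≤ n 0 (l + d) (solution? d χ l) (λ i j (i+j< , _) → z≤n , z≤n , i+j<)
    sol-high : ∀ i → i < a + u → 2 * sol (a + i) ≤ pronic (i + d ∸ a)
    sol-high i i<a+u = subst (λ y → 2 * sol (a + i) ≤ pronic y)
      (trans (cong (_∸ (a + a)) (ℕₚ.+-assoc a i d)) (ℕₚ.[m+n]∸[m+o]≡n∸o a (i + d) a))
      (ℕₚ.≤-trans (ℕₚ.*-monoʳ-≤ 2 restrict) (pairs≤ n a (a + i + d) high? (λ i j (p , q , r , _) → p , q , r)))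
      where
      l = a + i
      χl : χ l ≡ true
      χl = ≥⇒true (ℕₚ.+-monoʳ-< a i<a+u) (ℕₚ.m≤m+n a i)
      high? : ∀ i j → Dec (a ≤ i × a ≤ j × Solution d χ l i j)
      high? i j = a ≤? i ×-dec a ≤? j ×-dec solution? d χ l i j
      restrict : sol l ≤ ∑∑ n (λ i j → ⟦ high? i j ⟧)
      restrict = ∑ℕ-mono< n λ i i<n → ∑ℕ-mono< n λ j j<n → ⟦⟧-mono (solution? d χ l i j) (high? i j)
        λ { sl@(_ , i≡j , j≡l) → true⇒≥ i<n (trans i≡j (trans j≡l χl)) , true⇒≥ j<n (trans j≡l χl) , sl }
    ∑sol≤ : 2 * ∑ℕ n sol ≤ s + t
    ∑sol≤ = begin
      2 * ∑ℕ n sol                                             ≡⟨ ∑ℕ-*ˡ n 2 sol ⟨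
      ∑ℕ (a + (a + u)) (λ l → 2 * sol l)                       ≡⟨ ∑ℕ-split a (a + u) _ ⟩
      ∑ℕ a (λ l → 2 * sol l) + ∑ℕ (a + u) (λ i → 2 * sol (a + i))
        ≤⟨ ℕₚ.+-mono-≤ (∑ℕ-mono a sol-low) (∑ℕ-mono< (a + u) sol-high) ⟩
      s + t ∎
      where open ℕₚ.≤-Reasoning

-- Comparison with (1 + 2√2)⁻²

module _ where

  open import Data.Nat using (_+_; _*_; _≤_; _<_; _≤?_)

  ≡-by : ∀ {l r x y : ℕ} → l ≡ r → x + r ≡ y + l → x ≡ y
  ≡-by {l} {.l} {x} {y} refl eq = ℕₚ.+-cancelʳ-≡ l x y eq

  -- With E = a³ + u³ and D = (2a+u)³ − 9E this is 32 E² − D² = (a² − 2u²)² (31a² + 24au − 8u²):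
  -- the double root a = √2 u is where E/(2a+u)³ is minimal.
  discriminant : ∀ a u z q s →
    z + (a * a * a + 8 * (u * u * u)) ≡ 12 * (a * a * u) + 6 * (a * (u * u)) →
    q + 8 * (u * u) ≡ 31 * (a * a) + 24 * (a * u) →
    s + 4 * (a * a * (u * u)) ≡ a * a * (a * a) + 4 * (u * u * (u * u)) →
    32 * ((a * a * a + u * u * u) * (a * a * a + u * u * u)) ≡ z * z + s * q
  discriminant a u z q s hz hq hs = ≡-by
    -- `z`, `q` and `s` stand for differences. Their products are expanded by adding multiples of
    -- the three hypotheses to both sides, so that no subtraction occurs.
    (cong₂ _+_ (cong (U *_) (sym hz)) (cong₂ _+_ (cong (_* z) (sym hz)) (cong₂ _+_ (cong (_* T) hz)
      (cong₂ _+_ (cong (_* q) (sym hs)) (cong₂ _+_ (cong (P₄ *_) (sym hq)) (cong (4 * (a * a * (u * u)) *_) hq))))))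
    (identity a u z q s)
    where
    T = a * a * a + 8 * (u * u * u)
    U = 12 * (a * a * u) + 6 * (a * (u * u))
    P₄ = a * a * (a * a) + 4 * (u * u * (u * u))
    identity : ∀ a u z q s → let
        T = a * a * a + 8 * (u * u * u)
        U = 12 * (a * a * u) + 6 * (a * (u * u))
        P₄ = a * a * (a * a) + 4 * (u * u * (u * u))
        P₂ = 31 * (a * a) + 24 * (a * u)
        c = 4 * (a * a * (u * u)) in
      32 * ((a * a * a + u * u * u) * (a * a * a + u * u * u))
        + (U * (z + T) + ((z + T) * z + (U * T + ((s + c) * q + (P₄ * (q + 8 * (u * u)) + c * P₂)))))
      ≡ z * z + s * q
        + (U * U + (U * z + ((z + T) * T + (P₄ * q + (P₄ * P₂ + c * (q + 8 * (u * u)))))))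
    identity = ℕ-Solver.solve-∀

  square-gap : ∀ x y → ∃[ s ] s + 2 * (x * y) ≡ x * x + y * y
  square-gap x y with ℕₚ.≤-total x y
  ... | inj₁ x≤y with δ ← y ∸ x | refl ← ℕₚ.m+[n∸m]≡n x≤y = δ * δ , identity x δ
    where
    identity : ∀ x δ → δ * δ + 2 * (x * (x + δ)) ≡ x * x + (x + δ) * (x + δ)
    identity = ℕ-Solver.solve-∀
  ... | inj₂ y≤x with δ ← x ∸ y | refl ← ℕₚ.m+[n∸m]≡n y≤x = δ * δ , identity y δ
    where
    identity : ∀ y δ → δ * δ + 2 * ((y + δ) * y) ≡ (y + δ) * (y + δ) + y * y
    identity = ℕ-Solver.solve-∀

  -- The witness is (a² - 2u²)², obtained without fixing the sign of a² - 2u².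
  square-gap-2 : ∀ a u → ∃[ s ] s + 4 * (a * a * (u * u)) ≡ a * a * (a * a) + 4 * (u * u * (u * u))
  square-gap-2 a u with s , eq ← square-gap (a * a) (2 * (u * u)) =
    s , trans (cong (s +_) (double (a * a) (u * u))) (trans eq (cong (a * a * (a * a) +_) (square (u * u))))
    where
    double : ∀ x y → 4 * (x * y) ≡ 2 * (x * (2 * y))
    double = ℕ-Solver.solve-∀
    square : ∀ y → 2 * y * (2 * y) ≡ 4 * (y * y)
    square = ℕ-Solver.solve-∀

  cubic : ∀ {a u z} → 9 * (a * a * a + u * u * u) + z ≡ (a + a + u) * (a + a + u) * (a + a + u) →
          z + (a * a * a + 8 * (u * u * u)) ≡ 12 * (a * a * u) + 6 * (a * (u * u))
  cubic {a} {u} {z} eq = ≡-by eq (identity a u z)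
    where
    identity : ∀ a u z → z + (a * a * a + 8 * (u * u * u)) + (a + a + u) * (a + a + u) * (a + a + u) ≡
      12 * (a * a * u) + 6 * (a * (u * u)) + (9 * (a * a * a + u * u * u) + z)
    identity = ℕ-Solver.solve-∀

  -- Hölder's inequality (2a + u)³ ≤ (9 + 4√2)(a³ + u³).
  hölder : ∀ a u z → 9 * (a * a * a + u * u * u) + z ≤ (a + a + u) * (a + a + u) * (a + a + u) →
           z * z ≤ 32 * ((a * a * a + u * u * u) * (a * a * a + u * u * u))
  hölder a u z h = begin
    z * z              ≤⟨ sq-mono z≤z′ ⟩
    z′ * z′            ≤⟨ ℕₚ.m≤m+n (z′ * z′) (s * q) ⟩
    z′ * z′ + s * q    ≡⟨ discriminant a u z′ q s hz (ℕₚ.m∸n+n≡m (8u²≤ u hz)) hs ⟨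
    32 * (E * E)       ∎
    where
    open ℕₚ.≤-Reasoning
    E = a * a * a + u * u * u
    p³ = (a + a + u) * (a + a + u) * (a + a + u)
    z′ = p³ ∸ 9 * E
    z≤z′ : z ≤ z′
    z≤z′ = ℕₚ.m+n≤o⇒m≤o∸n z (subst (_≤ p³) (ℕₚ.+-comm (9 * E) z) h)
    hz : z′ + (a * a * a + 8 * (u * u * u)) ≡ 12 * (a * a * u) + 6 * (a * (u * u))
    hz = cubic {a} {u} (ℕₚ.m+[n∸m]≡n (ℕₚ.≤-trans (ℕₚ.m≤m+n (9 * E) z) h))
    -- The factor 31a² + 24au - 8u² can be negative in general, but not where D ≥ 0: there 8u³ ≤
    -- 12a²u + 6au², and one factor u cancels.
    8u²≤ : ∀ u → z′ + (a * a * a + 8 * (u * u * u)) ≡ 12 * (a * a * u) + 6 * (a * (u * u)) →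
           8 * (u * u) ≤ 31 * (a * a) + 24 * (a * u)
    8u²≤ zero    _  = z≤n
    8u²≤ u@(suc _) hz = ℕₚ.*-cancelˡ-≤ u (≤-by (z′ + a * a * a + 19 * (a * a * u) + 18 * (a * (u * u)))
      (ℕₚ.≤-reflexive hz) (identity a u z′))
      where
      identity : ∀ a u z → u * (8 * (u * u)) + (12 * (a * a * u) + 6 * (a * (u * u)))
        + (z + a * a * a + 19 * (a * a * u) + 18 * (a * (u * u)))
        ≡ u * (31 * (a * a) + 24 * (a * u)) + (z + (a * a * a + 8 * (u * u * u)))
      identity = ℕ-Solver.solve-∀
    q = 31 * (a * a) + 24 * (a * u) ∸ 8 * (u * u)
    s = proj₁ (square-gap-2 a u)
    hs = proj₂ (square-gap-2 a u)

  n≤n² : ∀ n → n ≤ n * n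
  n≤n² zero        = z≤n
  n≤n² n@(suc _) = ℕₚ.m≤m*n n n

  -- A colouring attaining the minimum is cut to the even length 2N, so 2a + u is n or n - 1. For n
  -- ≥ 1 one has N + 1 ≤ n, which turns the error into a multiple of n².
  cubes≤M : ∀ d n → 1 ≤ n → ∃[ a ] ∃[ u ] a + a + u ≤ n × n ≤ 1 + (a + a + u) ×
    a * a * a + u * u * u ≤ 12 * M -[1+ d ] n + 26 * (n * n)
  cubes≤M d n 1≤n = let a , u , p≡ , E≤ = cubes≤triangle χ N in
    a , u , ℕₚ.≤-trans (ℕₚ.≤-reflexive p≡) 2N≤n , ℕₚ.≤-trans n≤1+2N (s≤s (ℕₚ.≤-reflexive (sym p≡))) ,
    ℕₚ.≤-trans E≤ (ℕₚ.+-mono-≤ triangle≤M (ℕₚ.*-monoʳ-≤ 26 (sq-mono N+1≤n)))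
    where
    Δ = proj₁ (M-attained -[1+ d ] n)
    χ = extend Δ
    N = ⌊ n /2⌋
    2N≤n : N + N ≤ n
    2N≤n = ℕₚ.≤-trans (ℕₚ.+-monoʳ-≤ N (ℕₚ.⌊n/2⌋≤⌈n/2⌉ n)) (ℕₚ.≤-reflexive (ℕₚ.⌊n/2⌋+⌈n/2⌉≡n n))
    n≤1+2N : n ≤ 1 + (N + N)
    n≤1+2N = subst (_≤ 1 + (N + N)) (ℕₚ.⌊n/2⌋+⌈n/2⌉≡n n)
      (subst (N + ⌈ n /2⌉ ≤_) (ℕₚ.+-suc N N) (ℕₚ.+-monoʳ-≤ N (ℕₚ.⌊n/2⌋-mono (ℕₚ.n≤1+n (suc n)))))
    N+1≤n : N + 1 ≤ n
    N+1≤n = subst (_≤ n) (ℕₚ.+-comm 1 N) (half< 1≤n)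
      where
      half< : ∀ {n} → 1 ≤ n → ⌊ n /2⌋ < n
      half< {suc n} _ = ℕₚ.⌊n/2⌋<n n
    triangle≤M : 6 * triangle χ (N + N) ≤ 12 * M -[1+ d ] n
    triangle≤M = begin
      6 * triangle χ (N + N)        ≤⟨ ℕₚ.*-monoʳ-≤ 6 (triangle≤solutions χ 2N≤n) ⟩
      6 * ∑ℕ n (solutions 0 n χ)    ≤⟨ ℕₚ.*-monoʳ-≤ 6 (count-lower d n Δ) ⟩
      6 * (2 * count -[1+ d ] n Δ)  ≡⟨ ℕₚ.*-assoc 6 2 (count -[1+ d ] n Δ) ⟨
      12 * count -[1+ d ] n Δ       ≡⟨ cong (12 *_) (proj₂ (M-attained -[1+ d ] n)) ⟩
      12 * M -[1+ d ] n             ∎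
      where open ℕₚ.≤-Reasoning

  -- The 3 in `m + 3 * (n * n) ≤ b` leaves 36n² after multiplication by 12. This covers the 26n² in
  -- the bound on a³ + u³ and, after a further factor 9, the 7n² lost in replacing n³ by (2a + u)³.
  cubes⇒lower : ∀ m n b a u → 1 ≤ n → a + a + u ≤ n → n ≤ 1 + (a + a + u) →
    a * a * a + u * u * u ≤ 12 * m + 26 * (n * n) → m + 3 * (n * n) ≤ b → 108 * b ≤ n * n * n →
    ∃[ z ] n * n * n ≡ 108 * b + z × z * z ≤ 4608 * (b * b)
  cubes⇒lower m n b a u 1≤n p≤n n≤1+p E≤ M≤b 108b≤n³ =
    z , n³≡ , ℕₚ.≤-trans (hölder a u z 9E+z≤p³)
        (ℕₚ.≤-trans (ℕₚ.*-monoʳ-≤ 32 (sq-mono E≤12b)) (ℕₚ.≤-reflexive (square b)))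
    where
    E = a * a * a + u * u * u
    p = a + a + u
    z = n * n * n ∸ 108 * b
    n³≡ : n * n * n ≡ 108 * b + z
    n³≡ = sym (ℕₚ.m+[n∸m]≡n 108b≤n³)
    square : ∀ b → 32 * (12 * b * (12 * b)) ≡ 4608 * (b * b)
    square = ℕ-Solver.solve-∀
    E≤12b : E ≤ 12 * b
    E≤12b = ≤-by (10 * (n * n)) (ℕₚ.+-mono-≤ E≤ (ℕₚ.*-monoʳ-≤ 12 M≤b)) (identity E m n b)
      where
      identity : ∀ E m n b → E + (12 * m + 26 * (n * n) + 12 * b) + 10 * (n * n) ≡ 12 * b + (E + 12 * (m + 3 * (n * n)))
      identity = ℕ-Solver.solve-∀
    n³≤ : n * n * n ≤ p * p * p + 7 * (n * n)
    n³≤ = ≤-by 0 (ℕₚ.+-mono-≤ (cube-mono n≤1+p) (ℕₚ.+-mono-≤ (ℕₚ.*-monoʳ-≤ 3 (sq-mono p≤n))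
      (ℕₚ.+-mono-≤ (ℕₚ.*-monoʳ-≤ 3 (ℕₚ.≤-trans p≤n (n≤n² n))) (ℕₚ.≤-trans 1≤n (n≤n² n))))) (identity n p)
      where
      identity : ∀ n p → n * n * n + ((1 + p) * (1 + p) * (1 + p) + (3 * (n * n) + (3 * (n * n) + n * n))) + 0 ≡
        p * p * p + 7 * (n * n) + (n * n * n + (3 * (p * p) + (3 * p + 1)))
      identity = ℕ-Solver.solve-∀
    9E+z≤p³ : 9 * E + z ≤ p * p * p
    9E+z≤p³ = ≤-by (83 * (n * n)) (ℕₚ.+-mono-≤ (ℕₚ.≤-reflexive (sym n³≡)) (ℕₚ.+-mono-≤ n³≤
      (ℕₚ.+-mono-≤ (ℕₚ.*-monoʳ-≤ 9 E≤) (ℕₚ.*-monoʳ-≤ 108 M≤b)))) (identity E z b n p m (n * n * n))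
      where
      identity : ∀ E z b n p m c → 9 * E + z + (c + (p * p * p + 7 * (n * n) + (9 * (12 * m + 26 * (n * n)) + 108 * b))) + 83 * (n * n) ≡
        p * p * p + (108 * b + z + (c + (9 * E + 108 * (m + 3 * (n * n)))))
      identity = ℕ-Solver.solve-∀

  lower-bound : ∀ d n b → 1 ≤ n → M -[1+ d ] n + 3 * (n * n) ≤ b →
    n * n * n ≤ 108 * b ⊎ (∃[ z ] n * n * n ≡ 108 * b + z × z * z ≤ 4608 * (b * b))
  lower-bound d n b 1≤n M≤b = map₂ large (ℕₚ.≤-total (n * n * n) (108 * b))
    where
    large : 108 * b ≤ n * n * n → ∃[ z ] n * n * n ≡ 108 * b + z × z * z ≤ 4608 * (b * b)
    large = let a , u , p≤n , n≤1+p , E≤ = cubes≤M d n 1≤n in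
      cubes⇒lower (M -[1+ d ] n) n b a u 1≤n p≤n n≤1+p E≤ M≤b

  crossing-point : {P : ℕ → Set} → (∀ a → Dec (P a)) → ¬ P 0 → ∀ m → P m → ∃[ a ] ¬ P a × P (suc a)
  crossing-point P? ¬P0 zero    Pm = ⊥-elim (¬P0 Pm)
  crossing-point P? ¬P0 (suc m) Pm with P? m
  ... | yes Pm′ = crossing-point P? ¬P0 m Pm′
  ... | no ¬Pm′ = m , ¬Pm′ , Pm

  -- The colouring switches at a, and u = n − 2a; the optimal ratio a / u is √2, met here up to O(1).
  record Blocks (n : ℕ) : Set where
    field
      a u g  : ℕ
      n≡     : n ≡ a + (a + u)
      u≤a    : u ≤ a
      a≤2u   : a ≤ 2 * u
      a²+g≡  : a * a + g ≡ 2 * (u * u)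
      g≤8n   : g ≤ 8 * n

  -- The switch is placed where 2(n - 2a)² ≤ a² turns from false to true. One step of `a` changes u
  -- only by 2, so 2u² - a² stays of order n.
  blocks : ∀ n → 23 ≤ n → Blocks n
  blocks n 23≤n = record
    { a = a ; u = u ; g = g ; n≡ = n≡ ; u≤a = u≤a ; a≤2u = a≤2u ; a²+g≡ = a²+g≡ ; g≤8n = g≤8n }
    where
    P : ℕ → Set
    P a = 2 * ((n ∸ (a + a)) * (n ∸ (a + a))) ≤ a * a
    ¬P0 : ¬ P 0
    ¬P0 2n²≤0 = ℕₚ.n≮0 (ℕₚ.≤-trans (ℕₚ.≤-trans (ℕₚ.≤-trans (s≤s z≤n) 23≤n)
      (ℕₚ.≤-trans (n≤n² n) (ℕₚ.m≤m+n (n * n) _))) 2n²≤0)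
    Pn : P n
    Pn = subst (λ x → 2 * (x * x) ≤ n * n) (sym (ℕₚ.m≤n⇒m∸n≡0 (ℕₚ.m≤m+n n n))) z≤n
    point : ∃[ a ] ¬ P a × P (suc a)
    point = crossing-point (λ a → 2 * ((n ∸ (a + a)) * (n ∸ (a + a))) ≤? a * a) ¬P0 n Pn
    a = proj₁ point
    u = n ∸ (a + a)
    g = 2 * (u * u) ∸ a * a
    a²<2u² : a * a < 2 * (u * u)
    a²<2u² = ℕₚ.≰⇒> (proj₁ (proj₂ point))
    a²+g≡ : a * a + g ≡ 2 * (u * u)
    a²+g≡ = ℕₚ.m+[n∸m]≡n (ℕₚ.<⇒≤ a²<2u²)
    a≤2u : a ≤ 2 * u
    a≤2u = ℕₚ.≮⇒≥ λ 2u<a → ℕₚ.<⇒≱ a²<2u² (ℕₚ.≤-trans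
      (≤-slack (2 * (u * u)) (four u)) (sq-mono (ℕₚ.<⇒≤ 2u<a)))
      where
      four : ∀ u → 2 * (u * u) + 2 * (u * u) ≡ 2 * u * (2 * u)
      four = ℕ-Solver.solve-∀
    2a≤n : a + a ≤ n
    2a≤n = ℕₚ.≮⇒≥ λ n<2a → ℕₚ.n≮0 (subst (λ x → a * a < 2 * (x * x)) (ℕₚ.m≤n⇒m∸n≡0 (ℕₚ.<⇒≤ n<2a)) a²<2u²)
    n≡ : n ≡ a + (a + u)
    n≡ = trans (sym (ℕₚ.m+[n∸m]≡n 2a≤n)) (ℕₚ.+-assoc a a u)
    -- For u ≤ 6 the inequality a² < 2u² ≤ 72 gives a ≤ 8, hence n ≤ 22: this is the origin of 23.
    7≤u : 7 ≤ u
    7≤u = ℕₚ.≮⇒≥ λ { (s≤s u≤6) → ℕₚ.<⇒≱ 23≤n (subst (_≤ 22) (sym n≡)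
      (ℕₚ.+-mono-≤ (a≤8 u≤6) (ℕₚ.+-mono-≤ (a≤8 u≤6) u≤6))) }
      where
      a≤8 : u ≤ 6 → a ≤ 8
      a≤8 u≤6 = ℕₚ.≮⇒≥ λ 9≤a → ℕₚ.<⇒≱ a²<2u² (ℕₚ.≤-trans (ℕₚ.*-monoʳ-≤ 2 (sq-mono u≤6))
        (ℕₚ.≤-trans (ℕₚ.m≤m+n 72 9) (sq-mono 9≤a)))
    v = u ∸ 2
    w = u ∸ 7
    u≡2+v : u ≡ 2 + v
    u≡2+v = sym (ℕₚ.m+[n∸m]≡n (ℕₚ.≤-trans (ℕₚ.m≤m+n 2 5) 7≤u))
    u≡7+w : u ≡ 7 + w
    u≡7+w = sym (ℕₚ.m+[n∸m]≡n 7≤u)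
    2v²≤ : 2 * (v * v) ≤ suc a * suc a
    2v²≤ = subst (λ x → 2 * (x * x) ≤ suc a * suc a)
      (trans (cong (n ∸_) (reorder a)) (sym (ℕₚ.∸-+-assoc n (a + a) 2))) (proj₂ (proj₂ point))
      where
      reorder : ∀ a → suc a + suc a ≡ a + a + 2
      reorder = ℕ-Solver.solve-∀
    -- Otherwise 2(u - 2)² ≤ (a + 1)² ≤ u², but 2(u - 2)² > u² for u ≥ 7.
    u≤a : u ≤ a
    u≤a = ℕₚ.≮⇒≥ λ a<u → ℕₚ.n≮0 {0} (≤-by {x = 1} (6 * w + w * w) (ℕₚ.≤-trans 2v²≤ (sq-mono a<u))
      (subst₂ (λ u v → 1 + u * u + (6 * w + w * w) ≡ 0 + 2 * (v * v)) (sym u≡7+w)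
        (sym (ℕₚ.suc-injective (ℕₚ.suc-injective (trans (sym u≡2+v) u≡7+w)))) (identity w)))
      where
      identity : ∀ w → 1 + (7 + w) * (7 + w) + (6 * w + w * w) ≡ 0 + 2 * ((5 + w) * (5 + w))
      identity = ℕ-Solver.solve-∀
    -- Expanding 2(u - 2)² ≤ (a + 1)² gives g ≤ 8u + 2a - 7.
    g≤8n : g ≤ 8 * n
    g≤8n = ≤-by (7 + 14 * a) (ℕₚ.+-mono-≤ 2v²≤ (ℕₚ.≤-reflexive a²+g≡))
      (subst (λ n → g + (suc a * suc a + 2 * (u * u)) + (7 + 14 * a) ≡ 8 * n + (2 * (v * v) + (a * a + g))) (sym n≡)
        (subst (λ u → g + (suc a * suc a + 2 * (u * u)) + (7 + 14 * a) ≡ 8 * (a + (a + u)) + (2 * (v * v) + (a * a + g)))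
          (sym u≡2+v) (identity a v g)))
      where
      identity : ∀ a v g → g + ((1 + a) * (1 + a) + 2 * ((2 + v) * (2 + v))) + (7 + 14 * a) ≡
        8 * (a + (a + (2 + v))) + (2 * (v * v) + (a * a + g))
      identity = ℕ-Solver.solve-∀

  -- With D = 1 + d this is 3D + 3D² + D³, the coefficients of (a + D)³ beyond a³.
  κ : ℕ → ℕ
  κ d = (1 + d) * (3 + (1 + d) * (3 + (1 + d)))

  cube-shift≤ : ∀ d {a n} → 1 ≤ n → a ≤ n → (1 + (a + d)) * (1 + (a + d)) * (1 + (a + d)) ≤ a * a * a + κ d * (n * n)
  cube-shift≤ d {a} {n} 1≤n a≤n = ≤-by 0
    (ℕₚ.+-mono-≤ (ℕₚ.*-monoʳ-≤ (3 * (1 + d)) (sq-mono a≤n))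
      (ℕₚ.+-mono-≤ (ℕₚ.*-monoʳ-≤ (3 * ((1 + d) * (1 + d))) (ℕₚ.≤-trans a≤n (n≤n² n)))
        (ℕₚ.*-monoʳ-≤ ((1 + d) * (1 + d) * (1 + d)) (ℕₚ.≤-trans 1≤n (n≤n² n)))))
    (identity a d (n * n))
    where
    identity : ∀ a d N → (1 + (a + d)) * (1 + (a + d)) * (1 + (a + d))
      + (3 * (1 + d) * N + (3 * ((1 + d) * (1 + d)) * N + (1 + d) * (1 + d) * (1 + d) * N)) + 0 ≡
      a * a * a + (1 + d) * (3 + (1 + d) * (3 + (1 + d))) * N
      + (3 * (1 + d) * (a * a) + (3 * ((1 + d) * (1 + d)) * a + (1 + d) * (1 + d) * (1 + d) * 1))
    identity = ℕ-Solver.solve-∀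

  M≤cubes : ∀ d n → 1 ≤ n → (bl : Blocks n) → let open Blocks bl in
            12 * M -[1+ d ] n ≤ a * a * a + u * u * u + (2 * κ d + 6) * (n * n)
  M≤cubes d n 1≤n bl@(record { n≡ = refl }) = ≤-by 0
    (ℕₚ.+-mono-≤ (ℕₚ.≤-trans (ℕₚ.*-monoʳ-≤ 12 (proj₁ (proj₂ best))) (count-twoBlock≤ d a u (proj₁ best) (proj₂ (proj₂ best))))
      (ℕₚ.+-mono-≤ (cube-shift≤ d 1≤n (ℕₚ.m≤m+n a (a + u)))
                   (cube-shift≤ d 1≤n (ℕₚ.≤-trans (ℕₚ.m≤n+m u a) (ℕₚ.m≤n+m (a + u) a)))))
    (identity (12 * M -[1+ d ] n) ((1 + (a + d)) * (1 + (a + d)) * (1 + (a + d))) ((1 + (u + d)) * (1 + (u + d)) * (1 + (u + d)))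
      (a * a * a) (u * u * u) (κ d) (n * n))
    where
    open Blocks bl
    best = M-≤ -[1+ d ] n (twoBlock a)
    identity : ∀ m x y A U k N → m + (x + y + 6 * N + (A + k * N + (U + k * N))) + 0 ≡
      A + U + (2 * k + 6) * N + (m + (x + y))
    identity = ℕ-Solver.solve-∀

  -- Write E = a³ + u³ = 12m + 5n² + r; then n³ - 108m = D + 45n² + 9r. The discriminant identity
  -- gives 32E² = D² + g²q ≤ D² + 64 · 31 n⁴, and 64 · 31 = 1984 < 45² = 2025. So the 5 in `k + 5`
  -- pays for the distance of a / u from √2.
  cubes⇒upper : ∀ m n k → (bl : Blocks n) → let open Blocks bl in
    12 * (m + (k + 5) * (n * n)) ≤ a * a * a + u * u * u + (2 * k + 6) * (n * n) →
    ∃[ y ] n * n * n ≡ 108 * m + y × 4608 * (m * m) ≤ y * y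
  cubes⇒upper m n k bl M≤ = 45 * (n * n) + 9 * r + D , n³≡ , (begin
    4608 * (m * m)                               ≡⟨ square m ⟨
    32 * (12 * m * (12 * m))                     ≤⟨ ℕₚ.*-monoʳ-≤ 32 (sq-mono 12m≤E) ⟩
    32 * (E * E)                                 ≡⟨ discriminant a u D q (g * g) D+T≡U (ℕₚ.m∸n+n≡m 8u²≤) g²≡ ⟩
    D * D + g * g * q                            ≤⟨ ℕₚ.+-monoʳ-≤ (D * D) (ℕₚ.*-mono-≤ (sq-mono g≤8n) q≤) ⟩
    D * D + 8 * n * (8 * n) * (31 * (n * n))     ≤⟨ ≤-slack _ (last D n r) ⟩
    (45 * (n * n) + 9 * r + D) * (45 * (n * n) + 9 * r + D) ∎)
    where
    open ℕₚ.≤-Reasoning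
    open Blocks bl
    E = a * a * a + u * u * u
    T = a * a * a + 8 * (u * u * u)
    U = 12 * (a * a * u) + 6 * (a * (u * u))
    D = U ∸ T
    q = 31 * (a * a) + 24 * (a * u) ∸ 8 * (u * u)
    square : ∀ m → 32 * (12 * m * (12 * m)) ≡ 4608 * (m * m)
    square = ℕ-Solver.solve-∀
    last : ∀ D n r → D * D + 8 * n * (8 * n) * (31 * (n * n))
      + (41 * (n * n) * (n * n) + 9 * r * (9 * r) + 2 * (45 * (n * n)) * (9 * r) + 2 * (45 * (n * n)) * D + 2 * (9 * r) * D) ≡
      (45 * (n * n) + 9 * r + D) * (45 * (n * n) + 9 * r + D)
    last = ℕ-Solver.solve-∀
    T≤U : T ≤ U
    T≤U = ≤-by (8 * (a * a * u))
      (ℕₚ.+-mono-≤ (ℕₚ.*-monoʳ-≤ (a * a) a≤2u) (ℕₚ.+-mono-≤ (ℕₚ.*-monoˡ-≤ (6 * (u * u)) u≤a) (ℕₚ.*-monoˡ-≤ (2 * u) (sq-mono u≤a))))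
      (identity a u)
      where
      identity : ∀ a u → a * a * a + 8 * (u * u * u) + (a * a * (2 * u) + (a * (6 * (u * u)) + a * a * (2 * u))) + 8 * (a * a * u) ≡
        12 * (a * a * u) + 6 * (a * (u * u)) + (a * a * a + (u * (6 * (u * u)) + u * u * (2 * u)))
      identity = ℕ-Solver.solve-∀
    D+T≡U : D + T ≡ U
    D+T≡U = ℕₚ.m∸n+n≡m T≤U
    8u²≤ : 8 * (u * u) ≤ 31 * (a * a) + 24 * (a * u)
    8u²≤ = ≤-by (23 * (a * a) + 24 * (a * u)) (ℕₚ.*-monoʳ-≤ 8 (sq-mono u≤a)) (identity a u)
      where
      identity : ∀ a u → 8 * (u * u) + 8 * (a * a) + (23 * (a * a) + 24 * (a * u)) ≡ 31 * (a * a) + 24 * (a * u) + 8 * (u * u)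
      identity = ℕ-Solver.solve-∀
    q≤ : q ≤ 31 * (n * n)
    q≤ = ℕₚ.≤-trans (ℕₚ.m∸n≤m _ (8 * (u * u))) (subst (λ n → 31 * (a * a) + 24 * (a * u) ≤ 31 * (n * n)) (sym n≡)
      (≤-slack (93 * (a * a) + 100 * (a * u) + 31 * (u * u)) (identity a u)))
      where
      identity : ∀ a u → 31 * (a * a) + 24 * (a * u) + (93 * (a * a) + 100 * (a * u) + 31 * (u * u)) ≡
        31 * ((a + (a + u)) * (a + (a + u)))
      identity = ℕ-Solver.solve-∀
    g²≡ : g * g + 4 * (a * a * (u * u)) ≡ a * a * (a * a) + 4 * (u * u * (u * u))
    g²≡ = ≡-by (cong₂ _+_ (cong (2 * (a * a) *_) (sym a²+g≡)) (cong (λ x → x * x) a²+g≡)) (identity a u g)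
      where
      identity : ∀ a u g → g * g + 4 * (a * a * (u * u)) + (2 * (a * a) * (a * a + g) + 2 * (u * u) * (2 * (u * u))) ≡
        a * a * (a * a) + 4 * (u * u * (u * u)) + (2 * (a * a) * (2 * (u * u)) + (a * a + g) * (a * a + g))
      identity = ℕ-Solver.solve-∀
    12m+5n²≤E : 12 * m + 5 * (n * n) ≤ E
    12m+5n²≤E = ≤-by (49 * (n * n) + 10 * k * (n * n)) M≤ (identity m k (n * n) E)
      where
      identity : ∀ m k N E → 12 * m + 5 * N + (E + (2 * k + 6) * N) + (49 * N + 10 * k * N) ≡ E + 12 * (m + (k + 5) * N)
      identity = ℕ-Solver.solve-∀
    12m≤E : 12 * m ≤ E
    12m≤E = ℕₚ.≤-trans (ℕₚ.m≤m+n (12 * m) _) 12m+5n²≤E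
    r = E ∸ (12 * m + 5 * (n * n))
    n³≡ : n * n * n ≡ 108 * m + (45 * (n * n) + 9 * r + D)
    n³≡ = ≡-by (cong₂ _+_ (sym D+T≡U) (cong (9 *_) (sym (ℕₚ.m+[n∸m]≡n 12m+5n²≤E))))
      (trans (cong (λ p → p * p * p + (D + T + 9 * (12 * m + 5 * (n * n) + r))) n≡) (identity a u m (n * n) r D))
      where
      identity : ∀ a u m N r D → let p = a + (a + u) in
        p * p * p + (D + (a * a * a + 8 * (u * u * u)) + 9 * (12 * m + 5 * N + r)) ≡
        108 * m + (45 * N + 9 * r + D) + (12 * (a * a * u) + 6 * (a * (u * u)) + 9 * (a * a * a + u * u * u))
      identity = ℕ-Solver.solve-∀

  upper-bound : ∀ d n m → 23 ≤ n → m + (κ d + 5) * (n * n) ≡ M -[1+ d ] n →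
    ∃[ y ] n * n * n ≡ 108 * m + y × 4608 * (m * m) ≤ y * y
  upper-bound d n m 23≤n m≡ = cubes⇒upper m n (κ d) bl (subst (λ x → 12 * x ≤ E + (2 * κ d + 6) * (n * n)) (sym m≡)
    (M≤cubes d n (ℕₚ.≤-trans (s≤s z≤n) 23≤n) bl))
    where
    bl = blocks n 23≤n
    open Blocks bl
    E = a * a * a + u * u * u

-- Translation into the integer encoding of √2

open import Data.Integer using (+_; _+_; _-_; _*_; -_; _≤_)

√2≤-neg : ∀ c w → (+ 48 * - + w) √2≤ (+ c - + 108 * - + w)
√2≤-neg c w = inj₁
  ( subst (_≤ + 0) (trans (cong -_ (ℤₚ.pos-* 48 w)) (ℤₚ.neg-distribʳ-* (+ 48) (+ w))) (ℤₚ.neg-≤-pos {48 ℕ.* w} {0})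
  , subst (+ 0 ≤_) (trans (cong (λ x → + c + x) (ℤₚ.pos-* 108 w)) (identity (+ c) (+ w))) (ℤ.+≤+ ℕ.z≤n) )
  where
  identity : ∀ c w → c + + 108 * w ≡ c - + 108 * - w
  identity = ℤ-Solver.solve-∀

√2≤-upper : ∀ c m y → c ≡ 108 ℕ.* m ℕ.+ y → 4608 ℕ.* (m ℕ.* m) ℕ.≤ y ℕ.* y →
            (+ 48 * + m) √2≤ (+ c - + 108 * + m)
√2≤-upper c m y refl h = inj₂ (inj₂
  ( subst (+ 0 ≤_) (ℤₚ.pos-* 48 m) (ℤ.+≤+ ℕ.z≤n)
  , subst (+ 0 ≤_) (sym y≡) (ℤ.+≤+ ℕ.z≤n)
  , subst₂ _≤_ x²≡ (trans (ℤₚ.pos-* y y) (sym (cong₂ _*_ y≡ y≡))) (ℤ.+≤+ h) ))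
  where
  identity₁ : ∀ m y → m + y - m ≡ y
  identity₁ = ℤ-Solver.solve-∀
  y≡ : + (108 ℕ.* m ℕ.+ y) - + 108 * + m ≡ + y
  y≡ = trans (cong (λ x → + (108 ℕ.* m ℕ.+ y) - x) (sym (ℤₚ.pos-* 108 m))) (identity₁ (+ (108 ℕ.* m)) (+ y))
  identity₂ : ∀ m → + 4608 * (m * m) ≡ + 2 * (+ 48 * m) * (+ 48 * m)
  identity₂ = ℤ-Solver.solve-∀
  x²≡ : + (4608 ℕ.* (m ℕ.* m)) ≡ + 2 * (+ 48 * + m) * (+ 48 * + m)
  x²≡ = trans (ℤₚ.pos-* 4608 (m ℕ.* m)) (trans (cong (+ 4608 *_) (ℤₚ.pos-* m m)) (identity₂ (+ m)))

-- Negating both sides encodes c - 108b ≤ 48√2 b. If c ≤ 108b, the signs alone decide; otherwise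
-- both negated sides are nonpositive and the squares compare in reverse order.
√2≤-lower : ∀ c b → c ℕ.≤ 108 ℕ.* b ⊎ (∃[ z ] c ≡ 108 ℕ.* b ℕ.+ z × z ℕ.* z ℕ.≤ 4608 ℕ.* (b ℕ.* b)) →
            (- (+ 48 * + b)) √2≤ (- (+ c - + 108 * + b))
√2≤-lower c b h = by h
  where
  x≤0 : - (+ 48 * + b) ≤ + 0
  x≤0 = subst (_≤ + 0) (cong -_ (ℤₚ.pos-* 48 b)) (ℤₚ.neg-≤-pos {48 ℕ.* b} {0})
  by : c ℕ.≤ 108 ℕ.* b ⊎ (∃[ z ] c ≡ 108 ℕ.* b ℕ.+ z × z ℕ.* z ℕ.≤ 4608 ℕ.* (b ℕ.* b)) →
       (- (+ 48 * + b)) √2≤ (- (+ c - + 108 * + b))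
  by (inj₁ c≤) = inj₁ (x≤0 , ℤₚ.neg-mono-≤ (ℤₚ.i≤j⇒i-j≤0 (subst (+ c ≤_) (ℤₚ.pos-* 108 b) (ℤ.+≤+ c≤))))
  by (inj₂ (z , c≡ , z²≤)) = inj₂ (inj₁
    ( x≤0
    , subst (_≤ + 0) (sym y≡) (ℤₚ.neg-≤-pos {z} {0})
    , subst₂ _≤_ (trans (trans (ℤₚ.pos-* z z) (square (+ z))) (sym (cong₂ _*_ y≡ y≡)))
        (trans (ℤₚ.pos-* 4608 (b ℕ.* b)) (trans (cong (+ 4608 *_) (ℤₚ.pos-* b b)) (identity₂ (+ b)))) (ℤ.+≤+ z²≤) ))
    where
    square : ∀ x → x * x ≡ - x * - x
    square = ℤ-Solver.solve-∀
    identity₁ : ∀ x y → - (x + y - x) ≡ - y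
    identity₁ = ℤ-Solver.solve-∀
    identity₂ : ∀ x → + 4608 * (x * x) ≡ + 2 * (- (+ 48 * x)) * (- (+ 48 * x))
    identity₂ = ℤ-Solver.solve-∀
    y≡ : - (+ c - + 108 * + b) ≡ - + z
    y≡ = trans (cong₂ (λ x y → - (+ x - y)) c≡ (sym (ℤₚ.pos-* 108 b))) (identity₁ (+ (108 ℕ.* b)) (+ z))

-- The subtracted error may exceed the count. Then x ≤ 0, and 48√2 x ≤ 0 ≤ c - 108x holds by signs;
-- only a natural difference needs the hypothesis.
√2≤-difference : ∀ c m q → (∀ r → r ℕ.+ q ≡ m → ∃[ y ] c ≡ 108 ℕ.* r ℕ.+ y × 4608 ℕ.* (r ℕ.* r) ℕ.≤ y ℕ.* y) →
                 (+ 48 * (+ m - + q)) √2≤ (+ c - + 108 * (+ m - + q))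
√2≤-difference c m q h = by (ℕₚ.≤-total m q)
  where
  Goal : ℤ → Set
  Goal x = (+ 48 * x) √2≤ (+ c - + 108 * x)
  by : m ℕ.≤ q ⊎ q ℕ.≤ m → Goal (+ m - + q)
  by (inj₁ m≤q) = subst Goal (sym (trans (ℤₚ.m-n≡m⊖n m q) (ℤₚ.⊖-≤ m≤q))) (√2≤-neg c (q ℕ.∸ m))
  by (inj₂ q≤m) = let y , c≡ , r²≤ = h (m ℕ.∸ q) (ℕₚ.m∸n+n≡m q≤m) in
    subst Goal (sym (trans (ℤₚ.m-n≡m⊖n m q) (ℤₚ.⊖-≥ q≤m))) (√2≤-upper c (m ℕ.∸ q) y c≡ r²≤)

theorem1p4 : (k : ℤ) → k ≤ -[1+ 1 ] →
    ∃[ C ] ∃[ n₀ ] ∀ (n : ℕ) → n₀ ℕ.≤ n →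
    ((+ 48 * (+ M k n - + (C ℕ.* n ^ 2))) √2≤ (+ (n ^ 3) - + 108 * (+ M k n - + (C ℕ.* n ^ 2))))
    × ((- (+ 48 * (+ M k n + + (C ℕ.* n ^ 2)))) √2≤ (- (+ (n ^ 3) - + 108 * (+ M k n + + (C ℕ.* n ^ 2)))))
theorem1p4 -[1+ d ] _ = C , 23 , λ n 23≤n →
    √2≤-difference (n ^ 3) (M -[1+ d ] n) (C ℕ.* n ^ 2) (λ r r≡ →
      subst (λ c → ∃[ y ] c ≡ 108 ℕ.* r ℕ.+ y × 4608 ℕ.* (r ℕ.* r) ℕ.≤ y ℕ.* y) (n³≡ n)
        (upper-bound d n r 23≤n (trans (cong (λ x → r ℕ.+ C ℕ.* x) (n²≡ n)) r≡)))
  , √2≤-lower (n ^ 3) (M -[1+ d ] n ℕ.+ C ℕ.* n ^ 2)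
      (subst (λ c → c ℕ.≤ 108 ℕ.* b n ⊎ (∃[ z ] c ≡ 108 ℕ.* b n ℕ.+ z × z ℕ.* z ℕ.≤ 4608 ℕ.* (b n ℕ.* b n))) (n³≡ n)
        (lower-bound d n (b n) (ℕₚ.≤-trans (ℕₚ.m≤m+n 1 22) 23≤n)
          (ℕₚ.+-monoʳ-≤ (M -[1+ d ] n) (subst (3 ℕ.* (n ℕ.* n) ℕ.≤_) (cong (C ℕ.*_) (n²≡ n))
            (ℕₚ.*-monoˡ-≤ (n ℕ.* n) (ℕₚ.≤-trans (ℕₚ.m≤m+n 3 2) (ℕₚ.m≤n+m 5 (κ d))))))))
  where
  C : ℕ
  -- The upper estimate needs `κ d + 5`; the lower one needs only 3.
  C = κ d ℕ.+ 5
  b : ℕ → ℕ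
  b n = M -[1+ d ] n ℕ.+ C ℕ.* n ^ 2
  n²≡ : ∀ n → n ℕ.* n ≡ n ^ 2
  n²≡ n = cong (n ℕ.*_) (sym (ℕₚ.*-identityʳ n))
  n³≡ : ∀ n → n ℕ.* n ℕ.* n ≡ n ^ 3
  n³≡ n = trans (ℕₚ.*-assoc n n n) (cong (n ℕ.*_) (n²≡ n))
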